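{- Let $G$ be a pseudotree whose unique cycle $C_G$ has an odd number of vertices, and suppose $G$ is in simplest form. Suppose that one vertex $A$ of $C_G$ has degree $3$ in $G$ and all other vertices of $C_G$ have degree $2$, and let $B$ be the unique neighbor of $A$ not on $C_G$. Let $v(G)$ be the number of vertices of $G$. Then the nim-value $g(G)$ in graph chomp satisfies: $g(G)\ge 4$ if $B$ has odd degree; $g(G)=3$ if $B$ has even degree and $v(G)$ is odd; $g(G)=0$ if $B$ has even degree and $v(G)$ is even.
   Context: A pseudotree is a finite connected simple graph containing exactly one cycle. Graph chomp is played on a finite simple graph: two players alternate, and a move consists either of deleting one edge, or of deleting one vertex together with all edges incident to it. The player who makes the last move wins. The nim-value $g$ of a position is defined recursively: the empty graph has nim-value $0$, and $g(G)$ is the minimal nonnegative integer not equal to the nim-value of any position reachable from $G$ in one move. Regard a graph as the simplicial complex consisting of its vertices (as singletons) and its edges (as 2-element sets). An involution of a graph $G$ is a permutation $\tau$ of its vertices with $\tau^2=\mathrm{id}$ such that $\{x,y\}$ is an edge iff $\{\tau(x),\tau(y)\}$ is an edge; its fixed point set consists of the vertices and edges (as sets) fixed by $\tau$. $G$ is in simplest form if there is no involution $\tau\neq\mathrm{id}$ of $G$ whose fixed point set is a simplicial complex, i.e. no non-identity involution such that no edge has its two endpoints interchanged by $\tau$. -}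

module Defs where

open import Data.Nat using (ℕ; zero; suc; _+_; _*_; _≤_; _<_; _%_)
open import Data.Nat.Properties using (_≟_)
open import Data.Fin as F using (Fin; punchOut)
import Data.Fin.Properties as FP
open import Data.List using (List; []; _∷_; length; map; mapMaybe; _++_; allFin)
open import Data.List.Membership.Propositional using (_∈_)
open import Data.List.Relation.Unary.All using (All)
open import Data.List.Relation.Unary.Unique.Propositional using (Unique)
open import Data.Vec as V using (Vec; removeAt; fromList)
open import Data.Maybe using (Maybe; just; nothing)
open import Data.Product using (Σ; _×_; _,_; ∃)
open import Data.Sum using (_⊎_)
open import Data.Bool using (Bool; true; false; if_then_else_)
open import Relation.Nullary using (¬_; yes; no; Dec)
open import Relation.Nullary.Decidable using (⌊_⌋)
open import Relation.Binary.PropositionalEquality using (_≡_; _≢_)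
open import Function.Bundles using (_⇔_)

-- Finite simple graphs, given by a vertex count and an edge list.
-- An edge {x,y} is stored once, as the pair (x , y) with x < y.

record Graph : Set where
  constructor graph
  field
    n     : ℕ
    edges : List (Fin n × Fin n)
open Graph public

WellFormed : Graph → Set
WellFormed G = All (λ e → Data.Product.proj₁ e F.< Data.Product.proj₂ e) (edges G)
             × Unique (edges G)
  where import Data.Product

Adj : (G : Graph) → Fin (n G) → Fin (n G) → Set
Adj G x y = ((x , y) ∈ edges G) ⊎ ((y , x) ∈ edges G)

degL : ∀ {m} → Fin m → List (Fin m × Fin m) → ℕ
degL v [] = 0
degL v ((x , y) ∷ es) with v F.≟ x | v F.≟ y
... | no _  | no _  = degL v es
... | _     | _     = suc (degL v es)

deg : (G : Graph) → Fin (n G) → ℕ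
deg G v = degL v (edges G)

data Reach (G : Graph) : Fin (n G) → Fin (n G) → Set where
  here : ∀ {x} → Reach G x x
  step : ∀ {x y z} → Adj G x y → Reach G y z → Reach G x z

Connected : Graph → Set
Connected G = ∀ x y → Reach G x y

cycPairs : ∀ {A : Set} → List A → List (A × A)
cycPairs {A} [] = []
cycPairs {A} (x ∷ xs) = go (x ∷ xs)
  where
  go : List A → List (A × A)
  go [] = []
  go (y ∷ []) = (y , x) ∷ []
  go (y ∷ z ∷ r) = (y , z) ∷ go (z ∷ r)

IsCycle : (G : Graph) → List (Fin (n G)) → Set
IsCycle G c = 3 ≤ length c × Unique c
            × All (λ p → Adj G (Data.Product.proj₁ p) (Data.Product.proj₂ p)) (cycPairs c)
  where import Data.Product

CycEdge : ∀ {m} → List (Fin m) → Fin m → Fin m → Set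
CycEdge c x y = ((x , y) ∈ cycPairs c) ⊎ ((y , x) ∈ cycPairs c)

-- a cycle (as a subgraph) is determined by its edge set; "exactly one cycle"
-- means: there is a cycle, and every cycle has the same edge set as it.
UniqueCycle : Graph → Set
UniqueCycle G = Σ (List (Fin (n G))) λ c → IsCycle G c ×
  (∀ c' → IsCycle G c' → ∀ x y → CycEdge c' x y ⇔ CycEdge c x y)

IsPseudotree : Graph → Set
IsPseudotree G = Connected G × UniqueCycle G

IsInvolution : (G : Graph) → (Fin (n G) → Fin (n G)) → Set
IsInvolution G τ = (∀ x → τ (τ x) ≡ x) × (∀ x y → Adj G x y ⇔ Adj G (τ x) (τ y))

-- the fixed point set is a simplicial complex: no edge has its endpoints swapped
FixedSetIsComplex : (G : Graph) → (Fin (n G) → Fin (n G)) → Set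
FixedSetIsComplex G τ = ∀ x y → Adj G x y → ¬ (τ x ≡ y × τ y ≡ x)

SimplestForm : Graph → Set
SimplestForm G = ¬ (Σ (Fin (n G) → Fin (n G)) λ τ →
  IsInvolution G τ × (∃ λ x → τ x ≢ x) × FixedSetIsComplex G τ)

elem : ℕ → List ℕ → Bool
elem k [] = false
elem k (x ∷ xs) = if ⌊ k ≟ x ⌋ then true else elem k xs

-- minimal excludant; the search bound suc (length l) suffices since mex l ≤ length l
mex : List ℕ → ℕ
mex l = go (suc (length l)) 0
  where
  go : ℕ → ℕ → ℕ
  go zero m = m
  go (suc f) m = if elem m l then go f (suc m) else m

delV : ∀ {m} → Fin (suc m) → List (Fin (suc m) × Fin (suc m)) → List (Fin m × Fin m)
delV v = mapMaybe f
  where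
  f : _ → Maybe _
  f (x , y) with v F.≟ x | v F.≟ y
  ... | no p | no q = just (punchOut p , punchOut q)
  ... | _    | _    = nothing

gV : (m k : ℕ) → Vec (Fin m × Fin m) k → ℕ
gV zero zero V.[] = 0
gV zero (suc k) ((() , _) V.∷ _)
gV (suc m) zero es =
  mex (map (λ v → gV m (length (delV v [])) (fromList (delV v []))) (allFin (suc m)))
gV (suc m) (suc k) es =
  mex (map (λ v → gV m (length (delV v (V.toList es))) (fromList (delV v (V.toList es))))
           (allFin (suc m))
       ++ map (λ i → gV (suc m) k (removeAt es i)) (allFin (suc k)))

nim : Graph → ℕ
nim G = gV (n G) (length (edges G)) (fromList (edges G))

Even Odd : ℕ → Set
Even k = k % 2 ≡ 0
Odd k = k % 2 ≡ 1

{-# OPTIONS --safe #-}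
module Submission where

-- Let φ be the number with binary digits v mod 2 (low) and e mod 2 (high).
-- A bipartite graph has nim-value φ: deleting an edge flips the high digit,
-- deleting a vertex flips the low digit and, if its degree is odd, the high
-- one too; the vertices of either parity that are needed exist because
-- the degrees over all vertices sum to 2e and those over one colour class to e.
-- An odd cycle forming a component of an otherwise bipartite graph flips
-- both digits.  If instead the cycle hangs on a single edge AB, breaking the
-- cycle yields all values below four other than φ.  For B of odd degree,
-- deleting B yields φ itself, so the value is at least 4.  For B of even
-- degree, deleting B or AB does not yield φ, and every other move that keeps
-- the cycle leads, inductively, to a value of at least 4 or to its own φ,
-- which differs; hence the value is φ.  Finally e = v in a pseudotree.

open import Defs
open import Data.Nat using (ℕ; zero; suc; _+_; _%_; _≤_; _<_; z≤n; s≤s; _≤?_)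
open import Data.Nat.Properties as ℕₚ using ()
open import Data.Fin as F using (Fin; zero; suc; punchIn; punchOut)
import Data.Fin.Properties as FP
open import Data.List using (List; []; _∷_; _++_; length; map; allFin)
open import Data.List.Properties using (length-++; length-map)
open import Data.List.Membership.Propositional using (_∈_; _∉_)
open import Data.List.Membership.Propositional.Properties using (∈-∃++; ∈-map⁺; ∈-map⁻; ∈-++⁺ˡ; ∈-++⁺ʳ; ∈-++⁻; ∈-allFin)
open import Data.List.Relation.Unary.Any using (here; there)
open import Data.List.Relation.Unary.All as All using (All; []; _∷_)
open import Data.List.Relation.Unary.AllPairs using ([]; _∷_)
open import Data.List.Relation.Unary.Unique.Propositional using (Unique)
open import Data.List.Relation.Binary.Permutation.Propositional using (_↭_; prep; swap; ↭-refl; ↭-sym; ↭-trans; ↭-reflexive)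
import Data.List.Relation.Binary.Permutation.Propositional as Perm
open import Data.List.Relation.Binary.Permutation.Propositional.Properties using (∈-resp-↭; ↭-length; shift; drop-∷; mapMaybe-↭; map⁺; ++⁺ʳ; All-resp-↭)
open import Data.Vec as V using (Vec; removeAt; fromList; toList)
open import Data.Product using (Σ; ∃; ∃₂; _×_; _,_; proj₁; proj₂)
open import Data.Sum using (_⊎_; inj₁; inj₂)
open import Data.Bool using (Bool; true; false; not; _∧_; _∨_; _xor_; if_then_else_)
open import Data.Empty using (⊥)
open import Relation.Nullary using (¬_; yes; no; contradiction)
open import Relation.Nullary.Decidable using (⌊_⌋)
open import Relation.Binary.PropositionalEquality
open import Function using (_∘_)
import Data.Bool.Properties as Bool
open import Data.Bool.Properties using (not-involutive; xor-same; xor-identityʳ; ∧-identityʳ; ∧-zeroʳ; ∧-distribʳ-xor)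
open import Data.List.Membership.DecPropositional using (_∈?_)
open import Function.Bundles using (Equivalence)

Edge : ℕ → Set
Edge m = Fin m × Fin m

∈⇒↭ : {X : Set} {x : X} {xs : List X} → x ∈ xs → ∃ λ ys → xs ↭ x ∷ ys
∈⇒↭ x∈ with us , vs , refl ← ∈-∃++ x∈ = us ++ vs , shift _ us vs

-- Minimal excludants

elem-sound : ∀ k l → elem k l ≡ true → k ∈ l
elem-sound k (x ∷ l) eq with k ℕₚ.≟ x
... | yes refl = here refl
... | no _ = there (elem-sound k l eq)

elem-complete : ∀ k l → k ∈ l → elem k l ≡ true
elem-complete k (x ∷ l) k∈ with k ℕₚ.≟ x | k∈
... | yes _ | _ = refl
... | no k≢ | here eq = contradiction eq k≢
... | no _ | there k∈l = elem-complete k l k∈l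

search : List ℕ → ℕ → ℕ → ℕ
search l zero m = m
search l (suc f) m = if elem m l then search l f (suc m) else m

-- The search inside mex is local to it; abstracting its arguments lets
-- unification name it in the type of search-unfold.
mutual
  mex≡search : ∀ l → mex l ≡ search l (suc (length l)) 0
  mex≡search l with length l | 1
  ... | f | m = cong (λ k → if elem 0 l then k else 0) (search-unfold l f m)

  search-unfold : ∀ l f m → _ ≡ search l f m
  search-unfold l zero m = refl
  search-unfold l (suc f) m = cong (λ k → if elem m l then k else m) (search-unfold l f (suc m))

-- The search can only step past a number that lies in the list, so it never passes `k`; running out
-- of fuel also returns a number not beyond `k`.
search-≤ : ∀ l k → k ∉ l → ∀ f m → m ≤ k → search l f m ≤ k
search-≤ l k k∉ zero m m≤k = m≤k
search-≤ l k k∉ (suc f) m m≤k with elem m l in eq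
... | false = m≤k
... | true = search-≤ l k k∉ f (suc m)
  (ℕₚ.≤∧≢⇒< m≤k λ { refl → k∉ (elem-sound m l eq) })

-- The bound on `f + m` says that the fuel suffices to climb from `m` to `k`; a search that stops
-- earlier would stop at a member of the list.
search-≥ : ∀ l k → (∀ j → j < k → j ∈ l) → ∀ f m → k ≤ f + m → k ≤ search l f m
search-≥ l k below zero m k≤ = k≤
search-≥ l k below (suc f) m k≤ with elem m l in eq
... | true = search-≥ l k below f (suc m) (subst (k ≤_) (sym (ℕₚ.+-suc f m)) k≤)
... | false with k ≤? m
...   | yes k≤m = k≤m
...   | no k≰m = contradiction
  (trans (sym eq) (elem-complete m l (below m (ℕₚ.≰⇒> k≰m)))) λ ()

-- Pigeonhole: taking the largest of the numbers out of the list leaves the others in it.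
below⇒≤length : ∀ k l → (∀ j → j < k → j ∈ l) → k ≤ length l
below⇒≤length zero l below = z≤n
below⇒≤length (suc k) l below with l' , p ← ∈⇒↭ (below k ℕₚ.≤-refl) =
  subst (suc k ≤_) (sym (↭-length p)) (s≤s (below⇒≤length k l' below'))
  where
  below' : ∀ j → j < k → j ∈ l'
  below' j j<k with ∈-resp-↭ p (below j (ℕₚ.m<n⇒m<1+n j<k))
  ... | here refl = contradiction j<k (ℕₚ.<-irrefl refl)
  ... | there j∈ = j∈

mex-≥ : ∀ l k → (∀ j → j < k → j ∈ l) → k ≤ mex l
mex-≥ l k below rewrite mex≡search l = search-≥ l k below (suc (length l)) 0
  (ℕₚ.≤-trans (below⇒≤length k l below) (ℕₚ.≤-trans (ℕₚ.n≤1+n _) (ℕₚ.≤-reflexive (sym (ℕₚ.+-identityʳ _)))))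

mex-≡ : ∀ l k → (∀ j → j < k → j ∈ l) → k ∉ l → mex l ≡ k
mex-≡ l k below k∉ = ℕₚ.≤-antisym
  (subst (_≤ k) (sym (mex≡search l)) (search-≤ l k k∉ (suc (length l)) 0 z≤n))
  (mex-≥ l k below)

-- Moves

infix 4 _⟶_
-- The edge list left by an edge deletion is fixed only up to order. The structures tracked below
-- are stable under permutation, so invariance of `nim` under reordering is never called for.
data _⟶_ : Graph → Graph → Set where
  vertex : ∀ {m} {es} (v : Fin (suc m)) → graph (suc m) es ⟶ graph m (delV v es)
  edge : ∀ {m} {es es' : List (Edge m)} e → es ↭ e ∷ es' → graph m es ⟶ graph m es'

-- Stated for dependent pairs, since the lengths of the two vectors agree only propositionally.
fromList∘toList : ∀ {X : Set} {k} (v : Vec X k) →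
  _≡_ {A = Σ ℕ (Vec X)} (length (toList v) , fromList (toList v)) (k , v)
fromList∘toList V.[] = refl
fromList∘toList (x V.∷ v) = cong (λ { (k , w) → suc k , x V.∷ w }) (fromList∘toList v)

gV≡nim : ∀ {m k} (v : Vec (Edge m) k) → gV m k v ≡ nim (graph m (toList v))
gV≡nim v = cong (λ { (k , w) → gV _ k w }) (sym (fromList∘toList v))

toList∘fromList : ∀ {X : Set} (l : List X) → toList (fromList l) ≡ l
toList∘fromList [] = refl
toList∘fromList (x ∷ l) = cong (x ∷_) (toList∘fromList l)

removeAt-↭ : ∀ {X : Set} {k} (v : Vec X (suc k)) i → toList v ↭ V.lookup v i ∷ toList (removeAt v i)
removeAt-↭ (x V.∷ v) zero = ↭-refl
removeAt-↭ (x V.∷ y V.∷ v) (suc i) = ↭-trans (prep x (removeAt-↭ (y V.∷ v) i)) (swap _ _ ↭-refl)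

∈⇒lookup : ∀ {X : Set} {x : X} l → x ∈ l → ∃ λ i → V.lookup (fromList l) i ≡ x
∈⇒lookup (y ∷ l) (here refl) = zero , refl
∈⇒lookup (y ∷ l) (there x∈) with i , eq ← ∈⇒lookup l x∈ = suc i , eq

nimWithoutVertex : ∀ {m} → List (Edge (suc m)) → Fin (suc m) → ℕ
nimWithoutVertex {m} es v = nim (graph m (delV v es))

nimWithoutEdge : ∀ {m k} → Vec (Edge m) (suc k) → Fin (suc k) → ℕ
nimWithoutEdge {m} {k} es i = gV m k (removeAt es i)

-- Follows the clauses of `gV` literally, including the detour `toList (fromList es)`, so that
-- `nim-mex` holds by `refl`. The lemmas after it remove the detour.
options : ∀ {m} → List (Edge (suc m)) → List ℕ
options {m} [] = map (nimWithoutVertex []) (allFin (suc m))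
options {m} es@(_ ∷ _) = map (nimWithoutVertex (toList (fromList es))) (allFin (suc m))
  ++ map (nimWithoutEdge (fromList es)) (allFin (length es))

nim-mex : ∀ {m} (es : List (Edge (suc m))) → nim (graph (suc m) es) ≡ mex (options es)
nim-mex [] = refl
nim-mex (e ∷ es) = refl

option⇒move : ∀ {m} (es : List (Edge (suc m))) {k} → k ∈ options es →
  ∃ λ H → graph (suc m) es ⟶ H × nim H ≡ k
option⇒move [] k∈ with v , _ , eq ← ∈-map⁻ (nimWithoutVertex []) {xs = allFin _} k∈ = _ , vertex v , sym eq
option⇒move {m} es@(_ ∷ _) k∈
  with ∈-++⁻ (map (nimWithoutVertex (toList (fromList es))) (allFin (suc m))) k∈
... | inj₁ k∈ˡ with v , _ , eq ← ∈-map⁻ (nimWithoutVertex (toList (fromList es))) {xs = allFin _} k∈ˡ =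
      _ , vertex v , trans (cong (λ l → nimWithoutVertex l v) (sym (toList∘fromList es))) (sym eq)
... | inj₂ k∈ʳ with i , _ , eq ← ∈-map⁻ (nimWithoutEdge (fromList es)) {xs = allFin _} k∈ʳ =
      _ , edge _ (↭-trans (↭-reflexive (sym (toList∘fromList es))) (removeAt-↭ (fromList es) i))
        , trans (sym (gV≡nim (removeAt (fromList es) i))) (sym eq)

vertex-option : ∀ {m} (es : List (Edge (suc m))) v → nim (graph m (delV v es)) ∈ options es
vertex-option [] v = ∈-map⁺ (nimWithoutVertex []) (∈-allFin v)
vertex-option {m} es@(_ ∷ _) v = ∈-++⁺ˡ (subst
  (λ l → nimWithoutVertex l v ∈ map (nimWithoutVertex (toList (fromList es))) (allFin (suc m)))
  (toList∘fromList es)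
  (∈-map⁺ (nimWithoutVertex (toList (fromList es))) (∈-allFin v)))

edge-option : ∀ {m} (es : List (Edge (suc m))) {e} → e ∈ es →
  ∃ λ es' → es ↭ e ∷ es' × nim (graph (suc m) es') ∈ options es
edge-option {m} es@(_ ∷ _) e∈ with i , refl ← ∈⇒lookup es e∈ =
    toList (removeAt (fromList es) i)
  , ↭-trans (↭-reflexive (sym (toList∘fromList es))) (removeAt-↭ (fromList es) i)
  , subst (_∈ options es) (gV≡nim (removeAt (fromList es) i))
      (∈-++⁺ʳ (map (nimWithoutVertex (toList (fromList es))) (allFin (suc m)))
        (∈-map⁺ (nimWithoutEdge (fromList es)) (∈-allFin i)))

-- Deleting a vertex

lift : ∀ {m} → Fin (suc m) → Edge m → Edge (suc m)
lift v (x , y) = punchIn v x , punchIn v y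

touches : ∀ {m} → Fin m → Edge m → Bool
touches v (x , y) = ⌊ v F.≟ x ⌋ ∨ ⌊ v F.≟ y ⌋

toℕ : Bool → ℕ
toℕ b = if b then 1 else 0

degL-∷ : ∀ {m} (v : Fin m) e es → degL v (e ∷ es) ≡ toℕ (touches v e) + degL v es
degL-∷ v (x , y) es with v F.≟ x | v F.≟ y
... | no _ | no _ = refl
... | no _ | yes _ = refl
... | yes _ | no _ = refl
... | yes _ | yes _ = refl

degL-↭ : ∀ {m} (v : Fin m) {es es'} → es ↭ es' → degL v es ≡ degL v es'
degL-↭ v Perm.refl = refl
degL-↭ v {es = e ∷ es} {_ ∷ es'} (prep e p) rewrite degL-∷ v e es | degL-∷ v e es' =
  cong (toℕ (touches v e) +_) (degL-↭ v p)
degL-↭ v {es = e ∷ f ∷ es} {_ ∷ _ ∷ es'} (swap e f p)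
  rewrite degL-∷ v e (f ∷ es) | degL-∷ v f es | degL-∷ v f (e ∷ es') | degL-∷ v e es' | degL-↭ v p =
  begin
    a + (b + c) ≡⟨ ℕₚ.+-assoc a b c ⟨
    a + b + c   ≡⟨ cong (_+ c) (ℕₚ.+-comm a b) ⟩
    b + a + c   ≡⟨ ℕₚ.+-assoc b a c ⟩
    b + (a + c) ∎
  where
  open ≡-Reasoning
  a = toℕ (touches v e)
  b = toℕ (touches v f)
  c = degL v es'
degL-↭ v (Perm.trans p q) = trans (degL-↭ v p) (degL-↭ v q)

degL-++ : ∀ {m} (v : Fin m) es es' → degL v (es ++ es') ≡ degL v es + degL v es'
degL-++ v [] es' = refl
degL-++ v (e ∷ es) es' rewrite degL-∷ v e (es ++ es') | degL-∷ v e es | degL-++ v es es' =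
  sym (ℕₚ.+-assoc (toℕ (touches v e)) _ _)

touches-lift : ∀ {m} v (w : Fin m) e → touches (punchIn v w) (lift v e) ≡ touches w e
touches-lift v w (x , y) = cong₂ _∨_ (lemma x) (lemma y)
  where
  lemma : ∀ x → ⌊ punchIn v w F.≟ punchIn v x ⌋ ≡ ⌊ w F.≟ x ⌋
  lemma x with w F.≟ x | punchIn v w F.≟ punchIn v x
  ... | yes _ | yes _ = refl
  ... | no _ | no _ = refl
  ... | yes refl | no ne = contradiction refl ne
  ... | no ne | yes eq = contradiction (FP.punchIn-injective v w x eq) ne

touches-self : ∀ {m} v (e : Edge m) → touches v (lift v e) ≡ false
touches-self v (x , y) with v F.≟ punchIn v x | v F.≟ punchIn v y
... | no _ | no _ = refl
... | yes eq | _ = contradiction (sym eq) (FP.punchInᵢ≢i v x)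
... | no _ | yes eq = contradiction (sym eq) (FP.punchInᵢ≢i v y)

degL-map-lift : ∀ {m} v (w : Fin m) es → degL (punchIn v w) (map (lift v) es) ≡ degL w es
degL-map-lift v w [] = refl
degL-map-lift v w (e ∷ es)
  rewrite degL-∷ (punchIn v w) (lift v e) (map (lift v) es) | degL-∷ w e es
        | touches-lift v w e | degL-map-lift v w es = refl

-- `T` collects the edges at `v`. Counts, degrees and membership after a vertex deletion are all
-- read off from this decomposition.
delV-split : ∀ {m} (v : Fin (suc m)) es → ∃ λ T → es ↭ map (lift v) (delV v es) ++ T
  × All (λ e → touches v e ≡ true) T × length T ≡ degL v es
delV-split v [] = [] , ↭-refl , [] , refl
delV-split v ((x , y) ∷ es) with T , p , all , len ← delV-split v es with v F.≟ x in eqx | v F.≟ y in eqy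
... | no v≢x | no v≢y = T
  , ↭-trans (↭-reflexive (cong₂ (λ a b → (a , b) ∷ es)
      (sym (FP.punchIn-punchOut v≢x)) (sym (FP.punchIn-punchOut v≢y)))) (prep _ p)
  , all , len
... | no _ | yes _ = (x , y) ∷ T , ↭-trans (prep _ p) (↭-sym (shift (x , y) _ T))
  , cong₂ (λ a b → ⌊ a ⌋ ∨ ⌊ b ⌋) eqx eqy ∷ all , cong suc len
... | yes _ | no _ = (x , y) ∷ T , ↭-trans (prep _ p) (↭-sym (shift (x , y) _ T))
  , cong₂ (λ a b → ⌊ a ⌋ ∨ ⌊ b ⌋) eqx eqy ∷ all , cong suc len
... | yes _ | yes _ = (x , y) ∷ T , ↭-trans (prep _ p) (↭-sym (shift (x , y) _ T))
  , cong₂ (λ a b → ⌊ a ⌋ ∨ ⌊ b ⌋) eqx eqy ∷ all , cong suc len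

delV-length : ∀ {m} (v : Fin (suc m)) es → length es ≡ length (delV v es) + degL v es
delV-length v es with T , p , _ , len ← delV-split v es =
  trans (↭-length p) (trans (length-++ (map (lift v) (delV v es)))
    (cong₂ _+_ (length-map (lift v) (delV v es)) len))

delV-↭ : ∀ {m} (v : Fin (suc m)) {es es'} → es ↭ es' → delV v es ↭ delV v es'
delV-↭ v = mapMaybe-↭ _

∈-delV⁻ : ∀ {m} (v : Fin (suc m)) es {e} → e ∈ delV v es → lift v e ∈ es
∈-delV⁻ v es e∈ with T , p , _ ← delV-split v es =
  ∈-resp-↭ (↭-sym p) (∈-++⁺ˡ (∈-map⁺ (lift v) e∈))

lift-injective : ∀ {m} (v : Fin (suc m)) {e f} → lift v e ≡ lift v f → e ≡ f
lift-injective v eq = cong₂ _,_ (FP.punchIn-injective v _ _ (cong proj₁ eq))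
                                (FP.punchIn-injective v _ _ (cong proj₂ eq))

∈-delV⁺ : ∀ {m} (v : Fin (suc m)) es {e} → lift v e ∈ es → e ∈ delV v es
∈-delV⁺ v es {e} e∈ with T , p , all , _ ← delV-split v es
  with ∈-++⁻ (map (lift v) (delV v es)) (∈-resp-↭ p e∈)
... | inj₁ e∈ˡ with f , f∈ , eq ← ∈-map⁻ (lift v) e∈ˡ = subst (_∈ delV v es) (sym (lift-injective v eq)) f∈
-- Edges of `T` touch `v`, lifted edges never do.
... | inj₂ e∈ʳ = contradiction (trans (sym (All.lookup all e∈ʳ)) (touches-self v e)) λ ()

odd : ℕ → Bool
odd zero = false
odd (suc n) = not (odd n)

odd-+ : ∀ m n → odd (m + n) ≡ odd m xor odd n
odd-+ zero n = refl
odd-+ (suc m) n rewrite odd-+ m n with odd m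
... | true = not-involutive _
... | false = refl

odd-toℕ : ∀ b → odd (toℕ b) ≡ b
odd-toℕ true = refl
odd-toℕ false = refl

delV-odd-length : ∀ {m} (v : Fin (suc m)) es →
  odd (length (delV v es)) ≡ odd (length es) xor odd (degL v es)
delV-odd-length v es rewrite delV-length v es | odd-+ (length (delV v es)) (degL v es)
  with odd (length (delV v es)) | odd (degL v es)
... | true | true = refl
... | true | false = refl
... | false | true = refl
... | false | false = refl

-- Sums modulo two and the handshake lemma

⨁ : ∀ {m} → (Fin m → Bool) → Bool
⨁ {zero} f = false
⨁ {suc m} f = f zero xor ⨁ (f ∘ suc)

⨁-cong : ∀ {m} {f g : Fin m → Bool} → (∀ v → f v ≡ g v) → ⨁ f ≡ ⨁ g
⨁-cong {zero} f≗g = refl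
⨁-cong {suc m} f≗g = cong₂ _xor_ (f≗g zero) (⨁-cong (f≗g ∘ suc))

xor-interchange : ∀ a b c d → (a xor b) xor (c xor d) ≡ (a xor c) xor (b xor d)
xor-interchange true true true d = refl
xor-interchange true true false d = sym (not-involutive d)
xor-interchange true false true d = not-involutive d
xor-interchange true false false d = refl
xor-interchange false true true d = refl
xor-interchange false true false d = refl
xor-interchange false false c d = refl

⨁-xor : ∀ {m} (f g : Fin m → Bool) → ⨁ (λ v → f v xor g v) ≡ ⨁ f xor ⨁ g
⨁-xor {zero} f g = refl
⨁-xor {suc m} f g rewrite ⨁-xor (f ∘ suc) (g ∘ suc) = xor-interchange (f zero) (g zero) _ _

⨁-false : ∀ m → ⨁ {m} (λ _ → false) ≡ false
⨁-false zero = refl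
⨁-false (suc m) = ⨁-false m

⨁-true : ∀ m → ⨁ {m} (λ _ → true) ≡ odd m
⨁-true zero = refl
⨁-true (suc m) = cong not (⨁-true m)

⨁-witness : ∀ {m} (f : Fin m → Bool) → ⨁ f ≡ true → ∃ λ v → f v ≡ true
⨁-witness {suc m} f eq with f zero in eq₀
... | true = zero , eq₀
... | false with v , fv ← ⨁-witness (f ∘ suc) eq = suc v , fv

⨁-point : ∀ {m} (f : Fin m → Bool) x → ⨁ (λ v → f v ∧ ⌊ v F.≟ x ⌋) ≡ f x
⨁-point {suc m} f zero = trans (cong₂ _xor_ (∧-identityʳ (f zero))
  (trans (⨁-cong (λ v → ∧-zeroʳ (f (suc v)))) (⨁-false m))) (xor-identityʳ _)
⨁-point {suc m} f (suc x) = cong₂ _xor_ (∧-zeroʳ (f zero))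
  (trans (⨁-cong (λ v → cong (f (suc v) ∧_) (suc-≟ v))) (⨁-point (f ∘ suc) x))
  where
  suc-≟ : ∀ v → ⌊ suc v F.≟ suc x ⌋ ≡ ⌊ v F.≟ x ⌋
  suc-≟ v with v F.≟ x
  ... | yes _ = refl
  ... | no _ = refl

-- The size, modulo two, of the edge cut between the two colour classes.
cutParity : ∀ {m} → (Fin m → Bool) → List (Edge m) → Bool
cutParity c [] = false
cutParity c ((x , y) ∷ es) = (c x xor c y) xor cutParity c es

-- A loop touches its vertex once but enters the right side twice, so it may sit only at a vertex
-- coloured `false`.
⨁-touches : ∀ {m} (c : Fin m → Bool) x y → (x ≡ y → c x ≡ false) →
  ⨁ (λ v → c v ∧ touches v (x , y)) ≡ c x xor c y
⨁-touches c x y loop = trans (⨁-cong pointwise)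
  (trans (⨁-xor (λ v → c v ∧ ⌊ v F.≟ x ⌋) (λ v → c v ∧ ⌊ v F.≟ y ⌋))
    (cong₂ _xor_ (⨁-point c x) (⨁-point c y)))
  where
  pointwise : ∀ v → c v ∧ touches v (x , y) ≡ (c v ∧ ⌊ v F.≟ x ⌋) xor (c v ∧ ⌊ v F.≟ y ⌋)
  pointwise v with v F.≟ x | v F.≟ y | c v in eq
  ... | _ | _ | false = refl
  ... | no _ | no _ | true = refl
  ... | no _ | yes _ | true = refl
  ... | yes _ | no _ | true = refl
  ... | yes refl | yes refl | true = trans (sym eq) (loop refl)

-- Summing degrees over the class `true` counts an edge inside the class twice and a crossing edge
-- once.
handshake : ∀ {m} (c : Fin m → Bool) es → (∀ {x y} → (x , y) ∈ es → x ≡ y → c x ≡ false) →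
  ⨁ (λ v → c v ∧ odd (degL v es)) ≡ cutParity c es
handshake {m} c [] loop = trans (⨁-cong (λ v → ∧-zeroʳ (c v))) (⨁-false m)
handshake c ((x , y) ∷ es) loop = trans (⨁-cong pointwise)
  (trans (⨁-xor (λ v → c v ∧ touches v (x , y)) (λ v → c v ∧ odd (degL v es)))
    (cong₂ _xor_ (⨁-touches c x y (loop (here refl))) (handshake c es (loop ∘ there))))
  where
  pointwise : ∀ v → c v ∧ odd (degL v ((x , y) ∷ es))
    ≡ (c v ∧ touches v (x , y)) xor (c v ∧ odd (degL v es))
  pointwise v rewrite degL-∷ v (x , y) es | odd-+ (toℕ (touches v (x , y))) (degL v es)
    | odd-toℕ (touches v (x , y)) with c v
  ... | true = refl
  ... | false = refl

Proper : ∀ {m} → (Fin m → Bool) → List (Edge m) → Set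
Proper c es = ∀ {x y} → (x , y) ∈ es → c x xor c y ≡ true

Bipartite : ∀ {m} → List (Edge m) → Set
Bipartite es = ∃ λ c → Proper c es

Proper⇒loopless : ∀ {m} {c : Fin m → Bool} {es} → Proper c es → ∀ {x y} → (x , y) ∈ es → x ≢ y
Proper⇒loopless {c = c} proper {x} e∈ refl = contradiction (trans (sym (xor-same (c x))) (proper e∈)) λ ()

cutParity-proper : ∀ {m} (c : Fin m → Bool) es → Proper c es → cutParity c es ≡ odd (length es)
cutParity-proper c [] proper = refl
cutParity-proper c ((x , y) ∷ es) proper rewrite proper (here refl) =
  cong not (cutParity-proper c es (proper ∘ there))

cutParity-const : ∀ {m} (es : List (Edge m)) → cutParity (λ _ → true) es ≡ false
cutParity-const [] = refl
cutParity-const (e ∷ es) = cutParity-const es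

∧-true⁻ : ∀ a b → a ∧ b ≡ true → a ≡ true × b ≡ true
∧-true⁻ true true refl = refl , refl

-- Every edge has exactly one end in the class `true`, so the degrees over that class sum to the
-- number of edges.
oddVertex : ∀ {m} {es : List (Edge m)} → Bipartite es → odd (length es) ≡ true →
  ∃ λ v → odd (degL v es) ≡ true
oddVertex {es = es} (c , proper) eq
  with v , p ← ⨁-witness _ (trans (handshake c es (λ e∈ x≡y → contradiction x≡y (Proper⇒loopless {c = c} proper e∈)))
                                   (trans (cutParity-proper c es proper) eq)) =
  v , proj₂ (∧-true⁻ (c v) _ p)

-- Increasing each degree by one makes the even vertices the odd summands. The degrees of a loopless
-- graph sum to an even number, so the total has the parity of `m`.
evenVertex : ∀ {m} {es : List (Edge m)} → Bipartite es → odd m ≡ true →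
  ∃ λ v → odd (degL v es) ≡ false
evenVertex {m} {es} (c , proper) eq =
  let v , p = ⨁-witness (λ v → true xor odd (degL v es)) sum
  in v , trans (sym (not-involutive _)) (cong not p)
  where
  sum : ⨁ (λ v → true xor odd (degL v es)) ≡ true
  sum = trans (⨁-xor (λ _ → true) (λ v → odd (degL v es)))
    (cong₂ _xor_ (trans (⨁-true m) eq)
      (trans (handshake (λ _ → true) es (λ e∈ x≡y → contradiction x≡y (Proper⇒loopless {c = c} proper e∈)))
        (cutParity-const es)))

-- Nim-values below four as pairs of bits, low bit first

val : Bool → Bool → ℕ
val false false = 0
val true false = 1
val false true = 2
val true true = 3

val-injective : ∀ a b a' b' → val a b ≡ val a' b' → a ≡ a' × b ≡ b'
val-injective a b a' b' eq =
    trans (sym (low-val a b)) (trans (cong odd eq) (low-val a' b'))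
  , trans (sym (high-val a b)) (trans (cong high eq) (high-val a' b'))
  where
  high : ℕ → Bool
  high 0 = false
  high 1 = false
  high _ = true
  low-val : ∀ a b → odd (val a b) ≡ a
  low-val false false = refl
  low-val true false = refl
  low-val false true = refl
  low-val true true = refl
  high-val : ∀ a b → high (val a b) ≡ b
  high-val false false = refl
  high-val true false = refl
  high-val false true = refl
  high-val true true = refl

val<4 : ∀ a b → val a b < 4
val<4 false false = s≤s z≤n
val<4 true false = s≤s (s≤s z≤n)
val<4 false true = s≤s (s≤s (s≤s z≤n))
val<4 true true = s≤s (s≤s (s≤s (s≤s z≤n)))

-- A smaller number arises by clearing the high bit, with the low bit kept or flipped, or by
-- clearing the low bit alone.
val-below : (P : ℕ → Set) → ∀ a b →
  (a ≡ true → P (val (not a) b)) →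
  (b ≡ true → P (val a (not b))) →
  (b ≡ true → P (val (not a) (not b))) →
  ∀ j → j < val a b → P j
val-below P true false p q r zero (s≤s z≤n) = p refl
val-below P false true p q r zero j< = q refl
val-below P false true p q r (suc zero) j< = r refl
val-below P false true p q r (suc (suc j)) (s≤s (s≤s ()))
val-below P true true p q r zero j< = r refl
val-below P true true p q r (suc zero) j< = q refl
val-below P true true p q r (suc (suc zero)) j< = p refl
val-below P true true p q r (suc (suc (suc j))) (s≤s (s≤s (s≤s ())))

-- Flipping the two bits independently runs through all four values, from whichever one it starts.
below-four : (P : ℕ → Set) → ∀ a b →
  P (val a b) → P (val (not a) b) → P (val a (not b)) → P (val (not a) (not b)) →
  ∀ j → j < 4 → P j
below-four P false false p q r s = λ
  { 0 _ → p ; 1 _ → q ; 2 _ → r ; 3 _ → s ; (suc (suc (suc (suc j)))) (s≤s (s≤s (s≤s (s≤s ())))) }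
below-four P true false p q r s = λ
  { 0 _ → q ; 1 _ → p ; 2 _ → s ; 3 _ → r ; (suc (suc (suc (suc j)))) (s≤s (s≤s (s≤s (s≤s ())))) }
below-four P false true p q r s = λ
  { 0 _ → r ; 1 _ → s ; 2 _ → p ; 3 _ → q ; (suc (suc (suc (suc j)))) (s≤s (s≤s (s≤s (s≤s ())))) }
below-four P true true p q r s = λ
  { 0 _ → s ; 1 _ → r ; 2 _ → q ; 3 _ → p ; (suc (suc (suc (suc j)))) (s≤s (s≤s (s≤s (s≤s ())))) }

nim-val : ∀ {m} (es : List (Edge (suc m))) a b →
  (∀ {H} → graph (suc m) es ⟶ H → nim H ≢ val a b) →
  (a ≡ true → val (not a) b ∈ options es) →
  (b ≡ true → val a (not b) ∈ options es) →
  (b ≡ true → val (not a) (not b) ∈ options es) →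
  nim (graph (suc m) es) ≡ val a b
nim-val es a b avoid p q r = trans (nim-mex es)
  (mex-≡ (options es) (val a b) (val-below (_∈ options es) a b p q r) k∉)
  where
  k∉ : val a b ∉ options es
  k∉ k∈ with H , G⟶H , eq ← option⇒move es k∈ = avoid G⟶H eq

nim-≥4 : ∀ {m} (es : List (Edge (suc m))) a b →
  val a b ∈ options es → val (not a) b ∈ options es →
  val a (not b) ∈ options es → val (not a) (not b) ∈ options es →
  4 ≤ nim (graph (suc m) es)
nim-≥4 es a b p q r s = subst (4 ≤_) (sym (nim-mex es))
  (mex-≥ (options es) 4 (below-four (_∈ options es) a b p q r s))

-- Size of a position and its parity value

size : Graph → ℕ
size G = n G + length (edges G)

move-size : ∀ {G H} → G ⟶ H → size H < size G
move-size (vertex {m} {es} v) = s≤s (ℕₚ.+-monoʳ-≤ m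
  (subst (length (delV v es) ≤_) (sym (delV-length v es)) (ℕₚ.m≤m+n _ _)))
move-size {graph m es} {graph _ es'} (edge e p) =
  subst (λ k → m + length es' < m + k) (sym (↭-length p)) (ℕₚ.+-monoʳ-< m (ℕₚ.n<1+n _))

φ : ∀ {m} → List (Edge m) → ℕ
φ {m} es = val (odd m) (odd (length es))

not≢ : ∀ b → b ≢ not b
not≢ true ()
not≢ false ()

odd-length-↭ : ∀ {m} {es es' : List (Edge m)} {e} → es ↭ e ∷ es' → odd (length es) ≡ not (odd (length es'))
odd-length-↭ p = cong odd (↭-length p)

-- Bipartite graphs

Bipartite-⊆ : ∀ {m} {es es' : List (Edge m)} → (∀ {e} → e ∈ es' → e ∈ es) → Bipartite es → Bipartite es'
Bipartite-⊆ sub (c , proper) = c , proper ∘ sub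

Bipartite-edge : ∀ {m} {es es' : List (Edge m)} {e} → es ↭ e ∷ es' → Bipartite es → Bipartite es'
Bipartite-edge p = Bipartite-⊆ (∈-resp-↭ (↭-sym p) ∘ there)

Bipartite-vertex : ∀ {m} {es : List (Edge (suc m))} v → Bipartite es → Bipartite (delV v es)
Bipartite-vertex {es = es} v (c , proper) = c ∘ punchIn v , proper ∘ ∈-delV⁻ v es

-- Passing the degree parity as `d` lets a caller obtain the option already expressed in the bits of
-- the present graph.
φ-vertex : ∀ {m} (es : List (Edge (suc m))) v → nim (graph m (delV v es)) ≡ φ (delV v es) →
  ∀ {d} → odd (degL v es) ≡ d → val (not (odd (suc m))) (odd (length es) xor d) ∈ options es
φ-vertex {m} es v eq refl = subst (_∈ options es)
  (trans eq (cong₂ val (sym (not-involutive (odd m))) (delV-odd-length v es))) (vertex-option es v)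

φ-edge : ∀ {m} (es : List (Edge (suc m))) {e} → e ∈ es →
  (∀ {es'} → es ↭ e ∷ es' → nim (graph (suc m) es') ≡ φ es') →
  val (odd (suc m)) (not (odd (length es))) ∈ options es
φ-edge {m} es e∈ eq with es' , p , o ← edge-option es e∈ = subst (_∈ options es)
  (trans (eq p) (cong (val (odd (suc m))) (trans (sym (not-involutive _)) (cong not (sym (odd-length-↭ p)))))) o

xor-true : ∀ b → b xor true ≡ not b
xor-true true = refl
xor-true false = refl

odd-length⇒∈ : ∀ {m} (es : List (Edge m)) → odd (length es) ≡ true → ∃ λ e → e ∈ es
odd-length⇒∈ (e ∷ es) _ = e , here refl

-- `N` bounds the size, which every move lowers, so that the recursion over moves becomes
-- structural.
nim-bipartite′ : ∀ N {m} (es : List (Edge m)) → size (graph m es) < N → Bipartite es → nim (graph m es) ≡ φ es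
nim-bipartite′ (suc N) {zero} [] _ _ = refl
nim-bipartite′ (suc N) {zero} ((() , _) ∷ _) _ _
nim-bipartite′ (suc N) {suc m} es (s≤s size≤) bip = nim-val es _ _ avoid
  -- A vertex of even degree flips the low bit, any edge the high bit, a vertex of odd degree both.
  (λ a → let v , d = evenVertex bip a in subst (λ b → val _ b ∈ options es) (xor-identityʳ _)
     (φ-vertex es v (viaVertex v) d))
  (λ b → let e , e∈ = odd-length⇒∈ es b in φ-edge es e∈ viaEdge)
  (λ b → let v , d = oddVertex bip b in subst (λ b → val _ b ∈ options es) (xor-true _)
     (φ-vertex es v (viaVertex v) d))
  where
  viaVertex : ∀ v → nim (graph m (delV v es)) ≡ φ (delV v es)
  viaVertex v = nim-bipartite′ N (delV v es)
    (ℕₚ.<-≤-trans (move-size (vertex {es = es} v)) size≤) (Bipartite-vertex v bip)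
  viaEdge : ∀ {e es'} → es ↭ e ∷ es' → nim (graph (suc m) es') ≡ φ es'
  viaEdge {e} {es'} p = nim-bipartite′ N es'
    (ℕₚ.<-≤-trans (move-size (edge e p)) size≤) (Bipartite-edge p bip)
  avoid : ∀ {H} → graph (suc m) es ⟶ H → nim H ≢ φ es
  avoid (vertex v) eq = not≢ _ (proj₁ (val-injective _ _ _ _ (trans (sym (viaVertex v)) eq)))
  avoid (edge e p) eq = not≢ _ (trans (proj₂ (val-injective _ _ _ _ (trans (sym (viaEdge p)) eq))) (odd-length-↭ p))

nim-bipartite : ∀ {m} (es : List (Edge m)) → Bipartite es → nim (graph m es) ≡ φ es
nim-bipartite es = nim-bipartite′ _ es (ℕₚ.n<1+n _)

-- Detached odd cycles

-- S is the vertex set of the cycle; its oddness is encoded by cut: each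
-- edge inside S is the only monochromatic edge of some two-colouring.
record DetachedCycle {m} (es : List (Edge m)) (S : Fin m → Bool) : Set where
  field
    inhabited : ∃ λ s → S s ≡ true
    incident : ∀ s → S s ≡ true → ∃ λ t → S t ≡ true × s ≢ t × ((s , t) ∈ es ⊎ (t , s) ∈ es)
    closed : ∀ {x y} → (x , y) ∈ es → S x ≡ S y
    evenDeg : ∀ s → S s ≡ true → odd (degL s es) ≡ false
    cut : ∀ {x y es'} → es ↭ (x , y) ∷ es' → S x ≡ true → ∃ λ c → c x ≡ c y × Proper c es'

open DetachedCycle

true≢false : true ≢ false
true≢false ()

S-≢ : ∀ {m} (S : Fin m → Bool) {x y} → S x ≡ true → S y ≡ false → x ≢ y
S-≢ S Sx Sy refl = true≢false (trans (sym Sx) Sy)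

⌊≟⌋-≢ : ∀ {m} {x y : Fin m} → x ≢ y → ⌊ x F.≟ y ⌋ ≡ false
⌊≟⌋-≢ {x = x} {y} x≢y with x F.≟ y
... | yes x≡y = contradiction x≡y x≢y
... | no _ = refl

⌊≟⌋-sym : ∀ {m} (x y : Fin m) → ⌊ x F.≟ y ⌋ ≡ ⌊ y F.≟ x ⌋
⌊≟⌋-sym x y with x F.≟ y | y F.≟ x
... | yes _ | yes _ = refl
... | no _ | no _ = refl
... | yes x≡y | no y≢x = contradiction (sym x≡y) y≢x
... | no x≢y | yes y≡x = contradiction (sym y≡x) x≢y

⌊≟⌋-refl : ∀ {m} (x : Fin m) → ⌊ x F.≟ x ⌋ ≡ true
⌊≟⌋-refl x with x F.≟ x
... | yes _ = refl
... | no x≢x = contradiction refl x≢x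

touches-≢ : ∀ {m} {v x y : Fin m} → v ≢ x → v ≢ y → touches v (x , y) ≡ false
touches-≢ v≢x v≢y rewrite ⌊≟⌋-≢ v≢x | ⌊≟⌋-≢ v≢y = refl

touches-end : ∀ {m} (v x y : Fin m) → touches v (x , y) ≡ true → v ≡ x ⊎ v ≡ y
touches-end v x y t with v F.≟ x | v F.≟ y
... | yes v≡x | _ = inj₁ v≡x
... | no _ | yes v≡y = inj₂ v≡y

touches-S : ∀ {m} (S : Fin m → Bool) v x y → S x ≡ S y → touches v (x , y) ≡ true → S v ≡ S x
touches-S S v x y Sx≡Sy t with touches-end v x y t
... | inj₁ refl = refl
... | inj₂ refl = sym Sx≡Sy

degL-untouched : ∀ {m} (v : Fin m) es → (∀ {e} → e ∈ es → touches v e ≡ false) → degL v es ≡ 0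
degL-untouched v [] un = refl
degL-untouched v (e ∷ es) un rewrite degL-∷ v e es | un (here refl) = degL-untouched v es (un ∘ there)

unpunch : ∀ {m} {u s : Fin (suc m)} → u ≢ s → ∃ λ s' → punchIn u s' ≡ s
unpunch u≢s = punchOut u≢s , FP.punchIn-punchOut u≢s

detached-↭ : ∀ {m} {es es' : List (Edge m)} {S} → es ↭ es' → DetachedCycle es S → DetachedCycle es' S
detached-↭ p C .inhabited = inhabited C
detached-↭ p C .incident s Ss with incident C s Ss
... | t , St , s≢t , inj₁ e∈ = t , St , s≢t , inj₁ (∈-resp-↭ p e∈)
... | t , St , s≢t , inj₂ e∈ = t , St , s≢t , inj₂ (∈-resp-↭ p e∈)
detached-↭ p C .closed e∈ = closed C (∈-resp-↭ (↭-sym p) e∈)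
detached-↭ p C .evenDeg s Ss = trans (cong odd (degL-↭ s (↭-sym p))) (evenDeg C s Ss)
detached-↭ p C .cut q = cut C (↭-trans p q)

detached-edge : ∀ {m} {es es' : List (Edge m)} {S x y} → es ↭ (x , y) ∷ es' → S x ≡ false →
  DetachedCycle es S → DetachedCycle es' S
detached-edge {es = es} {es'} {S} {x} {y} p Sx C = record
  { inhabited = inhabited C
  ; incident = λ s Ss → let t , St , s≢t , e∈ = incident C s Ss in t , St , s≢t , survives Ss St e∈
  ; closed = λ e∈ → closed C (∈-resp-↭ (↭-sym p) (there e∈))
  ; evenDeg = λ s Ss → trans (cong odd (sym (begin
      degL s es                               ≡⟨ degL-↭ s p ⟩
      degL s ((x , y) ∷ es')                  ≡⟨ degL-∷ s (x , y) es' ⟩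
      toℕ (touches s (x , y)) + degL s es'    ≡⟨ cong (λ b → toℕ b + degL s es') (touches-≢ (S-≢ S Ss Sx) (S-≢ S Ss Sy)) ⟩
      degL s es'                              ∎))) (evenDeg C s Ss)
  -- Cutting the cycle before the outer edge is deleted gives a colouring that restricts to what
  -- remains.
  ; cut = λ q Sz → let c , mono , proper = cut C (↭-trans p (↭-trans (prep _ q) (swap _ _ ↭-refl))) Sz
                   in c , mono , proper ∘ there
  }
  where
  open ≡-Reasoning
  Sy : S y ≡ false
  Sy = trans (sym (closed C (∈-resp-↭ (↭-sym p) (here refl)))) Sx
  survives : ∀ {s t} → S s ≡ true → S t ≡ true → (s , t) ∈ es ⊎ (t , s) ∈ es → (s , t) ∈ es' ⊎ (t , s) ∈ es'
  survives Ss St (inj₁ e∈) with ∈-resp-↭ p e∈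
  ... | here refl = contradiction (trans (sym Ss) Sx) true≢false
  ... | there e∈' = inj₁ e∈'
  survives Ss St (inj₂ e∈) with ∈-resp-↭ p e∈
  ... | here refl = contradiction (trans (sym St) Sx) true≢false
  ... | there e∈' = inj₂ e∈'

-- By `closed` both ends of an edge lie on the same side of `S`, so no edge at `u` meets the cycle
-- and the degrees on the cycle stay as they are.
detached-vertex : ∀ {m} {es : List (Edge (suc m))} {S} u → S u ≡ false →
  DetachedCycle es S → DetachedCycle (delV u es) (S ∘ punchIn u)
detached-vertex {m} {es} {S} u Su C = record
  { inhabited = inhabited'
  ; incident = incident'
  ; closed = λ e∈ → closed C (∈-delV⁻ u es e∈)
  ; evenDeg = λ s Ss → trans (cong odd (sym (degree s Ss))) (evenDeg C (punchIn u s) Ss)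
  ; cut = cut'
  }
  where
  inside : ∀ {s} → S s ≡ true → ∃ λ s' → punchIn u s' ≡ s
  inside Ss = unpunch (≢-sym (S-≢ S Ss Su))
  inhabited' : ∃ λ s → S (punchIn u s) ≡ true
  inhabited' with s , Ss ← inhabited C with s' , refl ← inside Ss = s' , Ss
  incident' : ∀ s → S (punchIn u s) ≡ true → ∃ λ t → S (punchIn u t) ≡ true × s ≢ t
    × ((s , t) ∈ delV u es ⊎ (t , s) ∈ delV u es)
  incident' s Ss with incident C (punchIn u s) Ss
  ... | t , St , s≢t , e∈ with inside St
  ...   | t' , refl with e∈
  ...     | inj₁ e∈₁ = t' , St , s≢t ∘ cong (punchIn u) , inj₁ (∈-delV⁺ u es e∈₁)
  ...     | inj₂ e∈₂ = t' , St , s≢t ∘ cong (punchIn u) , inj₂ (∈-delV⁺ u es e∈₂)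
  degree : ∀ s → S (punchIn u s) ≡ true → degL (punchIn u s) es ≡ degL s (delV u es)
  degree s Ss with T , p , all , _ ← delV-split u es = begin
    degL (punchIn u s) es                                        ≡⟨ degL-↭ _ p ⟩
    degL (punchIn u s) (map (lift u) (delV u es) ++ T)           ≡⟨ degL-++ _ (map (lift u) (delV u es)) T ⟩
    degL (punchIn u s) (map (lift u) (delV u es)) + degL (punchIn u s) T
      ≡⟨ cong₂ _+_ (degL-map-lift u s (delV u es)) (degL-untouched _ T untouched) ⟩
    degL s (delV u es) + 0                                       ≡⟨ ℕₚ.+-identityʳ _ ⟩
    degL s (delV u es)                                           ∎
    where
    open ≡-Reasoning
    untouched : ∀ {e} → e ∈ T → touches (punchIn u s) e ≡ false
    untouched {x , y} e∈ with touches (punchIn u s) (x , y) in eq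
    ... | false = refl
    ... | true = contradiction
      (trans (sym Ss) (trans (touches-S S (punchIn u s) x y Sx≡Sy eq) (trans (sym (touches-S S u x y Sx≡Sy (All.lookup all e∈))) Su)))
      true≢false
      where
      Sx≡Sy : S x ≡ S y
      Sx≡Sy = closed C (∈-resp-↭ (↭-sym p) (∈-++⁺ʳ (map (lift u) (delV u es)) e∈))
  -- The cut is made in `es`, and the colouring found there is restricted along `punchIn u`.
  cut' : ∀ {x y es'} → delV u es ↭ (x , y) ∷ es' → S (punchIn u x) ≡ true →
    ∃ λ c → c x ≡ c y × Proper c es'
  cut' q Sx with T , p , _ ← delV-split u es
    with c , mono , proper ← cut C (↭-trans p (++⁺ʳ T (map⁺ (lift u) q))) Sx =
    c ∘ punchIn u , mono , λ e∈ → proper (∈-++⁺ˡ (∈-map⁺ (lift u) e∈))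

-- Deleting an end of `e` removes `e` as well, so it is enough to colour the other edges properly.
-- Thus deleting a cycle vertex is no worse than cutting a cycle edge at it.
Bipartite-end : ∀ {m} {es es' : List (Edge (suc m))} {e} v → es ↭ e ∷ es' → touches v e ≡ true →
  Bipartite es' → Bipartite (delV v es)
Bipartite-end {es = es} v p t (c , proper) = c ∘ punchIn v , proper'
  where
  proper' : Proper (c ∘ punchIn v) (delV v es)
  proper' {x} {y} e∈ with ∈-resp-↭ p (∈-delV⁻ v es e∈)
  ... | there e∈' = proper e∈'
  ... | here refl = contradiction (trans (sym t) (touches-self v (x , y))) true≢false

touches-left : ∀ {m} (x y : Fin m) → touches x (x , y) ≡ true
touches-left x y rewrite ⌊≟⌋-refl x = refl

touches-right : ∀ {m} (x y : Fin m) → touches y (x , y) ≡ true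
touches-right x y rewrite ⌊≟⌋-refl y with ⌊ y F.≟ x ⌋
... | true = refl
... | false = refl

innerEdge : ∀ {m} {es : List (Edge m)} {S} → DetachedCycle es S → ∀ s → S s ≡ true →
  ∃₂ λ x y → (x , y) ∈ es × S x ≡ true × touches s (x , y) ≡ true
innerEdge C s Ss with incident C s Ss
... | t , St , _ , inj₁ e∈ = s , t , e∈ , Ss , touches-left s t
... | t , St , _ , inj₂ e∈ = t , s , e∈ , St , touches-right t s

detached-inner-vertex : ∀ {m} {es : List (Edge (suc m))} {S} → DetachedCycle es S →
  ∀ s → S s ≡ true → Bipartite (delV s es)
detached-inner-vertex C s Ss with x , y , e∈ , Sx , t ← innerEdge C s Ss with es' , p ← ∈⇒↭ e∈
  with c , _ , proper ← cut C p Sx = Bipartite-end s p t (c , proper)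

detached-inner-edge : ∀ {m} {es es' : List (Edge m)} {S x y} → DetachedCycle es S →
  es ↭ (x , y) ∷ es' → S x ≡ true → Bipartite es'
detached-inner-edge C p Sx with c , _ , proper ← cut C p Sx = c , proper

-- Cutting one cycle edge leaves its ends in one colour class; the other class
-- is then met by an odd number of edges and avoids the ends.
detached-odd-vertex : ∀ {m} {es : List (Edge m)} {S} → DetachedCycle es S → odd (length es) ≡ false →
  ∃ λ v → odd (degL v es) ≡ true
detached-odd-vertex {m} {es} C even with s , Ss ← inhabited C
  with x , y , e∈ , Sx , _ ← innerEdge C s Ss with es' , p ← ∈⇒↭ e∈
  with c , mono , proper ← cut C p Sx =
  let v , d = ⨁-witness _ sum in v , trans (cong odd (degL-↭ v p)) (proj₂ (∧-true⁻ (c' v) _ d))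
  where
  c' : Fin m → Bool
  -- Shifting the colours gives both ends of the cut edge the colour `false`, so that this edge adds
  -- nothing to the degrees over the class `true`.
  c' v = c v xor c x
  c'x : c' x ≡ false
  c'x = xor-same (c x)
  c'y : c' y ≡ false
  c'y = trans (cong (_xor c x) (sym mono)) c'x
  proper' : Proper c' es'
  proper' {u} {w} f∈ = trans (xor-interchange (c u) (c x) (c w) (c x))
    (trans (cong ((c u xor c w) xor_) (xor-same (c x))) (trans (xor-identityʳ _) (proper f∈)))
  -- For the cut edge the colour of its ends settles the loop condition; the remaining edges are
  -- bichromatic.
  loop : ∀ {u w} → (u , w) ∈ (x , y) ∷ es' → u ≡ w → c' u ≡ false
  loop (here refl) _ = c'x
  loop (there f∈) u≡w = contradiction u≡w (Proper⇒loopless {c = c'} proper' f∈)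
  sum : ⨁ (λ v → c' v ∧ odd (degL v ((x , y) ∷ es'))) ≡ true
  sum = trans (handshake c' ((x , y) ∷ es') loop)
    (trans (cong₂ (λ a b → (a xor b) xor cutParity c' es') c'x c'y)
    (trans (cutParity-proper c' es' proper')
    (trans (sym (not-involutive _)) (cong not (trans (sym (odd-length-↭ p)) even)))))

φ̅ : ∀ {m} → List (Edge m) → ℕ
φ̅ {m} es = val (not (odd m)) (not (odd (length es)))

-- Relative to the claimed value, cutting a cycle edge flips the low bit and deleting a cycle
-- vertex, whose degree is even, the high bit. For both flips at once a vertex of odd degree is
-- deleted; it lies off the cycle, so induction gives its value.
nim-detached′ : ∀ N {m} (es : List (Edge m)) {S} → size (graph m es) < N → DetachedCycle es S →
  nim (graph m es) ≡ φ̅ es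
nim-detached′ (suc N) {zero} es _ C with () , _ ← inhabited C
nim-detached′ (suc N) {suc m} es {S} (s≤s size≤) C with s , Ss ← inhabited C
  with x , y , e∈ , Sx , _ ← innerEdge C s Ss = nim-val es _ _ avoid
  (λ _ → subst (λ a → val a (not (odd (length es))) ∈ options es) (sym (not-involutive _))
    (φ-edge es e∈ (λ p → nim-bipartite _ (detached-inner-edge C p Sx))))
  (λ _ → subst (λ b → val (not (odd (suc m))) b ∈ options es)
    (trans (xor-identityʳ _) (sym (not-involutive _)))
    (φ-vertex es s (nim-bipartite _ (detached-inner-vertex C s Ss)) (evenDeg C s Ss)))
  oddMove
  where
  viaVertex : ∀ v → S v ≡ false → nim (graph m (delV v es)) ≡ φ̅ (delV v es)
  viaVertex v Sv = nim-detached′ N (delV v es)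
    (ℕₚ.<-≤-trans (move-size (vertex {es = es} v)) size≤) (detached-vertex v Sv C)
  viaEdge : ∀ {u w es'} → es ↭ (u , w) ∷ es' → S u ≡ false → nim (graph (suc m) es') ≡ φ̅ es'
  viaEdge {es' = es'} p Su = nim-detached′ N es'
    (ℕₚ.<-≤-trans (move-size (edge _ p)) size≤) (detached-edge p Su C)
  oddMove : not (odd (length es)) ≡ true →
    val (not (not (odd (suc m)))) (not (not (odd (length es)))) ∈ options es
  oddMove b with v , d ← detached-odd-vertex C (trans (sym (not-involutive _)) (cong not b)) with S v in Sv
  ... | true = contradiction (trans (sym d) (evenDeg C v Sv)) true≢false
  ... | false = subst (_∈ options es) (trans (viaVertex v Sv) (cong₂ val (sym (not-involutive _)) eq)) (vertex-option es v)
    where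
    eq : not (odd (length (delV v es))) ≡ not (not (odd (length es)))
    eq rewrite delV-odd-length v es | d = cong not (xor-true _)
  avoid : ∀ {H} → graph (suc m) es ⟶ H → nim H ≢ φ̅ es
  avoid (vertex v) eq with S v in Sv
  ... | true = not≢ _ (trans (sym (xor-identityʳ _)) (trans (cong (odd (length es) xor_) (sym (evenDeg C v Sv)))
    (trans (sym (delV-odd-length v es))
    (proj₂ (val-injective _ _ _ _ (trans (sym (nim-bipartite _ (detached-inner-vertex C v Sv))) eq))))))
  ... | false = not≢ _ (proj₁ (val-injective _ _ _ _ (trans (sym (viaVertex v Sv)) eq)))
  avoid (edge {es' = es'} (u , w) p) eq with S u in Su
  ... | true = not≢ _ (proj₁ (val-injective _ _ _ _ (trans (sym (nim-bipartite _ (detached-inner-edge C p Su))) eq)))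
  ... | false = not≢ _ (trans (proj₂ (val-injective _ _ _ _ (trans (sym (viaEdge p Su)) eq))) (cong not (odd-length-↭ p)))

nim-detached : ∀ {m} (es : List (Edge m)) {S} → DetachedCycle es S → nim (graph m es) ≡ φ̅ es
nim-detached es = nim-detached′ _ es (ℕₚ.n<1+n _)

-- Odd cycles attached by a single edge

Joins : ∀ {m} → Edge m → Fin m → Fin m → Set
Joins e A B = e ≡ (A , B) ⊎ e ≡ (B , A)

-- The bridge is split off so that the facts about the cycle can be inherited from `rest`, where the
-- cycle is detached. `Joins` allows either orientation, since the stored order of the ends reflects
-- only the vertex numbering.
record AttachedCycle {m} (es : List (Edge m)) (S : Fin m → Bool) (A B : Fin m) : Set where
  field
    {rest} : List (Edge m)
    {bridge} : Edge m
    joins : Joins bridge A B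
    split : es ↭ bridge ∷ rest
    detached : DetachedCycle rest S
    A-inside : S A ≡ true
    B-outside : S B ≡ false

delV-touched : ∀ {m} (v : Fin (suc m)) e es → touches v e ≡ true → delV v (e ∷ es) ≡ delV v es
delV-touched v (x , y) es t with v F.≟ x | v F.≟ y
... | yes _ | _ = refl
... | no _ | yes _ = refl

delV-lift : ∀ {m} (v : Fin (suc m)) e es → delV v (lift v e ∷ es) ≡ e ∷ delV v es
delV-lift v (x , y) es with v F.≟ punchIn v x | v F.≟ punchIn v y
... | yes eq | _ = contradiction (sym eq) (FP.punchInᵢ≢i v x)
... | no _ | yes eq = contradiction (sym eq) (FP.punchInᵢ≢i v y)
... | no p | no q = cong₂ (λ a b → (a , b) ∷ delV v es)
  (FP.punchIn-injective v _ _ (FP.punchIn-punchOut p)) (FP.punchIn-injective v _ _ (FP.punchIn-punchOut q))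

joins-lift : ∀ {m} (u : Fin (suc m)) {e A B} → Joins e (punchIn u A) (punchIn u B) →
  ∃ λ e' → lift u e' ≡ e × Joins e' A B
joins-lift u (inj₁ refl) = _ , refl , inj₁ refl
joins-lift u (inj₂ refl) = _ , refl , inj₂ refl

touches-joins-A : ∀ {m} {e} {A B : Fin m} → Joins e A B → touches A e ≡ true
touches-joins-A {A = A} {B} (inj₁ refl) = touches-left A B
touches-joins-A {A = A} {B} (inj₂ refl) = touches-right B A

touches-joins-B : ∀ {m} {e} {A B : Fin m} → Joins e A B → touches B e ≡ true
touches-joins-B {A = A} {B} (inj₁ refl) = touches-right A B
touches-joins-B {A = A} {B} (inj₂ refl) = touches-left B A

touches-joins-≢ : ∀ {m} {e} {A B v : Fin m} → Joins e A B → v ≢ A → v ≢ B → touches v e ≡ false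
touches-joins-≢ (inj₁ refl) v≢A v≢B = touches-≢ v≢A v≢B
touches-joins-≢ (inj₂ refl) v≢A v≢B = touches-≢ v≢B v≢A

-- Two deletions from the same list either remove the same entry or commute.
↭-cons-cons : {X : Set} {es rest es' : List X} {a e : X} → es ↭ a ∷ rest → es ↭ e ∷ es' →
  (e ≡ a × rest ↭ es') ⊎ (∃ λ es″ → rest ↭ e ∷ es″ × es' ↭ a ∷ es″)
↭-cons-cons p q with ∈-resp-↭ p (∈-resp-↭ (↭-sym q) (here refl))
... | here refl = inj₁ (refl , drop-∷ (↭-trans (↭-sym p) q))
... | there e∈ with es″ , r ← ∈⇒↭ e∈ =
  inj₂ (es″ , r , drop-∷ (↭-trans (↭-sym q) (↭-trans p (↭-trans (prep _ r) (swap _ _ ↭-refl)))))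

-- If P separates the ends of e but of no other edge, switching the colours on P makes e bichromatic.
recolour : ∀ {m} {es : List (Edge m)} {c P : Fin m → Bool} {e} → Proper c es →
  (∀ {u w} → (u , w) ∈ es → P u ≡ P w) → P (proj₁ e) xor P (proj₂ e) ≡ true → Bipartite (e ∷ es)
recolour {m} {es} {c} {P} {x , y} proper respects separates = c' , proper'
  where
  k : Bool
  -- The switch is made only when the ends of `e` have equal colours.
  k = not (c x xor c y)
  c' : Fin m → Bool
  c' v = c v xor (P v ∧ k)
  xor-not : ∀ b → b xor not b ≡ true
  xor-not true = refl
  xor-not false = refl
  c'-xor : ∀ u w → c' u xor c' w ≡ (c u xor c w) xor ((P u xor P w) ∧ k)
  c'-xor u w = trans (xor-interchange (c u) (P u ∧ k) (c w) (P w ∧ k))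
    (cong ((c u xor c w) xor_) (sym (∧-distribʳ-xor k (P u) (P w))))
  proper' : Proper c' ((x , y) ∷ es)
  proper' (here refl) = trans (c'-xor x y)
    (trans (cong (λ p → (c x xor c y) xor (p ∧ k)) separates) (xor-not (c x xor c y)))
  proper' {u} {w} (there e∈) = trans (c'-xor u w)
    (trans (cong (λ p → (c u xor c w) xor (p ∧ k)) (trans (cong (_xor P w) (respects e∈)) (xor-same (P w))))
    (trans (xor-identityʳ _) (proper e∈)))

module _ {m} {es : List (Edge m)} {S A B} (L : AttachedCycle es S A B) where
  open AttachedCycle L

  bridge-leaves : S (proj₁ bridge) xor S (proj₂ bridge) ≡ true
  bridge-leaves with joins
  ... | inj₁ refl = cong₂ _xor_ A-inside B-outside
  ... | inj₂ refl = cong₂ _xor_ B-outside A-inside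

  -- With a cycle edge gone, `rest` is two-coloured. Only the bridge leaves `S`, so switching the
  -- colours on `S` can accommodate it.
  attached-cut : ∀ {x y es'} → rest ↭ (x , y) ∷ es' → S x ≡ true → Bipartite (bridge ∷ es')
  attached-cut p Sx with c , _ , proper ← cut detached p Sx =
    recolour {c = c} {P = S} proper (λ e∈ → closed detached (∈-resp-↭ (↭-sym p) (there e∈))) bridge-leaves

  -- The outcomes for a cycle edge, for the bridge and for an edge off the cycle, in this order.
  data EdgeDeleted (es' : List (Edge m)) : Set where
    bipartite : Bipartite es' → EdgeDeleted es'
    detaches : DetachedCycle es' S → EdgeDeleted es'
    attached : AttachedCycle es' S A B → EdgeDeleted es'

  attached-edge : ∀ {e es'} → es ↭ e ∷ es' → EdgeDeleted es'
  attached-edge {x , y} q with ↭-cons-cons split q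
  ... | inj₁ (_ , r) = detaches (detached-↭ r detached)
  ... | inj₂ (es″ , r , r') with S x in Sx
  ...   | true = bipartite (Bipartite-⊆ (∈-resp-↭ r') (attached-cut r Sx))
  ...   | false = attached record
    { joins = joins ; split = r' ; detached = detached-edge r Sx detached
    ; A-inside = A-inside ; B-outside = B-outside }

  attached-inner-edge : ∀ {x y es'} → (x , y) ∈ rest → S x ≡ true → es ↭ (x , y) ∷ es' → Bipartite es'
  attached-inner-edge {x} {y} e∈ Sx q with ↭-cons-cons split q
  ... | inj₂ (_ , r , r') = Bipartite-⊆ (∈-resp-↭ r') (attached-cut r Sx)
  -- An edge of `rest` stays on one side of `S`, whereas the bridge changes sides.
  ... | inj₁ (refl , _) = contradiction
    (trans (sym (xor-same (S y))) (trans (cong (_xor S y) (sym (closed detached e∈))) bridge-leaves)) λ ()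

  attached-degree : ∀ v → odd (degL v es) ≡ touches v bridge xor odd (degL v rest)
  attached-degree v rewrite degL-↭ v split | degL-∷ v bridge rest
    | odd-+ (toℕ (touches v bridge)) (degL v rest) | odd-toℕ (touches v bridge) = refl

  evenDeg-inner : ∀ s → S s ≡ true → s ≢ A → odd (degL s es) ≡ false
  evenDeg-inner s Ss s≢A rewrite attached-degree s
    | touches-joins-≢ joins s≢A (S-≢ S Ss B-outside) = evenDeg detached s Ss

  oddDeg-A : odd (degL A es) ≡ true
  oddDeg-A rewrite attached-degree A | touches-joins-A joins | evenDeg detached A A-inside = refl

  ∈-rest : ∀ {e} → e ∈ rest → e ∈ es
  ∈-rest e∈ = ∈-resp-↭ (↭-sym split) (there e∈)

module _ {m} {es : List (Edge (suc m))} {S A B} (L : AttachedCycle es S A B) where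
  open AttachedCycle L

  attached-inner-vertex : ∀ s → S s ≡ true → Bipartite (delV s es)
  attached-inner-vertex s Ss with x , y , e∈ , Sx , t ← innerEdge detached s Ss with es' , p ← ∈⇒↭ e∈ =
    Bipartite-end s (↭-trans split (↭-trans (prep _ p) (swap _ _ ↭-refl))) t (attached-cut L p Sx)

  -- The bridge disappears along with `B`; what is left is `rest` with a vertex off the cycle
  -- deleted.
  attached-B : DetachedCycle (delV B es) (S ∘ punchIn B)
  attached-B = detached-↭
    (↭-trans (↭-reflexive (sym (delV-touched B bridge rest (touches-joins-B joins)))) (delV-↭ B (↭-sym split)))
    (detached-vertex B B-outside detached)

  attached-vertex : ∀ u → S u ≡ false → u ≢ B →
    ∃₂ λ A' B' → AttachedCycle (delV u es) (S ∘ punchIn u) A' B'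
  attached-vertex u Su u≢B with A' , refl ← unpunch (≢-sym (S-≢ S A-inside Su))
    with B' , refl ← unpunch u≢B
    with e' , eq , joins' ← joins-lift u joins = A' , B' , record
    { joins = joins'
    ; split = ↭-trans (delV-↭ u split) (↭-reflexive (trans (cong (λ e → delV u (e ∷ rest)) (sym eq)) (delV-lift u e' rest)))
    ; detached = detached-vertex u Su detached
    ; A-inside = A-inside
    ; B-outside = B-outside }

AttachedValue : ∀ {m} → List (Edge m) → Fin m → Set
AttachedValue {m} es B = (odd (degL B es) ≡ true → 4 ≤ nim (graph m es))
                       × (odd (degL B es) ≡ false → nim (graph m es) ≡ φ es)

-- Serves the moves that keep the cycle attached: whatever the parity of the degree of `B`
-- afterwards, the value is at least four or a known different one.
attached-≢ : ∀ {m} (es : List (Edge m)) B {a b} → AttachedValue es B → φ es ≢ val a b → nim (graph m es) ≢ val a b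
attached-≢ es B {a} {b} (large , small) ≢val eq with odd (degL B es)
... | true = ℕₚ.<-irrefl refl (ℕₚ.<-≤-trans (val<4 a b) (subst (4 ≤_) eq (large refl)))
... | false = ≢val (trans (sym (small refl)) eq)

-- Only `avoid` recurses; every option needed for a lower bound is bipartite or has its cycle
-- detached.
nim-attached′ : ∀ N {m} (es : List (Edge m)) {S A B} → size (graph m es) < N → AttachedCycle es S A B →
  AttachedValue es B
nim-attached′ (suc N) {suc m} es {S} {A} {B} (s≤s size≤) L = large , small
  where
  open AttachedCycle L
  a b : Bool
  a = odd (suc m)
  b = odd (length es)
  inner : ∀ {d} → ∃ (λ s → S s ≡ true × odd (degL s es) ≡ d) → val (not a) (b xor d) ∈ options es
  inner (s , Ss , d) = φ-vertex es s (nim-bipartite _ (attached-inner-vertex L s Ss)) d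
  -- `A` is the only cycle vertex of odd degree, so deleting a cycle neighbour of it flips the low
  -- bit alone, while deleting `A` flips both.
  even-option : val (not a) b ∈ options es
  even-option with t , St , A≢t , _ ← incident detached A A-inside =
    subst (λ c → val (not a) c ∈ options es) (xor-identityʳ _)
      (inner (t , St , evenDeg-inner L t St (≢-sym A≢t)))
  odd-option : val (not a) (not b) ∈ options es
  odd-option = subst (λ c → val (not a) c ∈ options es) (xor-true _) (inner (A , A-inside , oddDeg-A L))
  cut-option : val a (not b) ∈ options es
  cut-option with x , y , e∈ , Sx , _ ← innerEdge detached A A-inside =
    φ-edge es (∈-rest L e∈) (λ p → nim-bipartite _ (attached-inner-edge L e∈ Sx p))
  large : odd (degL B es) ≡ true → 4 ≤ nim (graph (suc m) es)
  large d = nim-≥4 es a b (subst (_∈ options es) viaB (vertex-option es B)) even-option cut-option odd-option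
    where
    -- Deleting `B` flips both parities, and the now detached cycle flips both back.
    viaB : nim (graph m (delV B es)) ≡ val a b
    viaB = trans (nim-detached _ (attached-B L)) (cong (val a)
      (trans (cong not (trans (delV-odd-length B es) (trans (cong (b xor_) d) (xor-true b)))) (not-involutive b)))
  small : odd (degL B es) ≡ false → nim (graph (suc m) es) ≡ φ es
  small d = nim-val es a b avoid (λ _ → even-option) (λ _ → cut-option) (λ _ → odd-option)
    where
    avoid : ∀ {H} → graph (suc m) es ⟶ H → nim H ≢ val a b
    avoid (vertex v) eq with S v in Sv
    ... | true = not≢ _ (proj₁ (val-injective _ _ _ _ (trans (sym (nim-bipartite _ (attached-inner-vertex L v Sv))) eq)))
    ... | false with v F.≟ B
    -- With `B` of even degree the edge parity survives its deletion, and the detached cycle then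
    -- flips the high bit.
    ...   | yes refl = not≢ b (trans (sym (proj₂ (val-injective _ _ _ _ (trans (sym (nim-detached _ (attached-B L))) eq))))
      (cong not (trans (delV-odd-length B es) (trans (cong (b xor_) d) (xor-identityʳ b)))))
    -- The move may change the parity of the degree of `B`, but a value below four would have the
    -- low bit flipped.
    ...   | no v≢B with A' , B' , L' ← attached-vertex L v Sv v≢B =
      attached-≢ (delV v es) B' (nim-attached′ N (delV v es) (ℕₚ.<-≤-trans (move-size (vertex {es = es} v)) size≤) L')
        (λ eq' → not≢ _ (proj₁ (val-injective _ _ _ _ eq'))) eq
    avoid (edge {es' = es'} e p) eq with attached-edge L p
    ... | bipartite bip = not≢ _ (trans (proj₂ (val-injective _ _ _ _ (trans (sym (nim-bipartite _ bip)) eq))) (odd-length-↭ p))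
    -- Deleting the bridge keeps the vertex count, and the detached cycle flips the low bit.
    ... | detaches C = not≢ a (sym (proj₁ (val-injective _ _ _ _ (trans (sym (nim-detached _ C)) eq))))
    ... | attached L' = attached-≢ es' B (nim-attached′ N es' (ℕₚ.<-≤-trans (move-size (edge e p)) size≤) L')
      (λ eq' → not≢ _ (trans (proj₂ (val-injective _ _ _ _ eq')) (odd-length-↭ p))) eq

nim-attached : ∀ {m} (es : List (Edge m)) {S A B} → AttachedCycle es S A B → AttachedValue es B
nim-attached es = nim-attached′ _ es (ℕₚ.n<1+n _)

-- Cycles as lists

-- The local worker of `cycPairs` with its starting vertex made explicit, so that induction can run
-- along the list; `closing-unfold` reaches the worker by unification, as `search-unfold` does.
closing : {X : Set} → X → List X → List (X × X)
closing x [] = []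
closing x (y ∷ []) = (y , x) ∷ []
closing x (y ∷ z ∷ r) = (y , z) ∷ closing x (z ∷ r)

mutual
  cycPairs≡closing : ∀ {X : Set} (x : X) xs → cycPairs (x ∷ xs) ≡ closing x (x ∷ xs)
  cycPairs≡closing x xs with x ∷ xs
  ... | ys = closing-unfold x xs ys

  closing-unfold : ∀ {X : Set} (x : X) xs ys → _ ≡ closing x ys
  closing-unfold x xs [] = refl
  closing-unfold x xs (y ∷ []) = refl
  closing-unfold x xs (y ∷ z ∷ r) = cong ((y , z) ∷_) (closing-unfold x xs (z ∷ r))

closing-∈ : ∀ {X : Set} {x : X} ys {a b} → (a , b) ∈ closing x ys → a ∈ ys × (b ∈ ys ⊎ b ≡ x)
closing-∈ (y ∷ []) (here refl) = here refl , inj₂ refl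
closing-∈ (y ∷ z ∷ r) (here refl) = here refl , inj₁ (there (here refl))
closing-∈ (y ∷ z ∷ r) (there p) with closing-∈ (z ∷ r) p
... | a∈ , inj₁ b∈ = there a∈ , inj₁ (there b∈)
... | a∈ , inj₂ b≡ = there a∈ , inj₂ b≡

cycPairs-∈ : ∀ {X : Set} (C : List X) {a b} → (a , b) ∈ cycPairs C → a ∈ C × b ∈ C
cycPairs-∈ (x ∷ xs) {a} {b} p with closing-∈ (x ∷ xs) (subst ((a , b) ∈_) (cycPairs≡closing x xs) p)
... | a∈ , inj₁ b∈ = a∈ , b∈
... | a∈ , inj₂ refl = a∈ , here refl

closing-last : ∀ {X : Set} (x y : X) ys → ∃ λ l → l ∈ y ∷ ys × (l , x) ∈ closing x (y ∷ ys)
closing-last x y [] = y , here refl , here refl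
closing-last x y (z ∷ r) with l , l∈ , p ← closing-last x z r = l , there l∈ , there p

-- The list is an arc that starts at `p` and finally closes up at `x`. Uniqueness separates
-- predecessor and successor inside the arc, and `x ∉ p ∷ ys` does so at its end.
closing-mid : ∀ {X : Set} {x p : X} ys {s} → Unique (p ∷ ys) → x ∉ p ∷ ys → s ∈ ys →
  ∃₂ λ t₁ t₂ → t₁ ≢ t₂ × (t₁ , s) ∈ closing x (p ∷ ys) × (s , t₂) ∈ closing x (p ∷ ys)
closing-mid (s ∷ []) u x∉ (here refl) = _ , _ , (λ { refl → x∉ (here refl) }) , here refl , there (here refl)
closing-mid (s ∷ z ∷ r) ((_ ∷ p≢z ∷ _) ∷ _) x∉ (here refl) = _ , _ , p≢z , here refl , there (here refl)
closing-mid (y ∷ ys@(_ ∷ _)) (_ ∷ u) x∉ (there s∈) with t₁ , t₂ , ne , p , q ← closing-mid ys u (x∉ ∘ there) s∈ =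
  t₁ , t₂ , ne , there p , there q

closing-neighbours : ∀ {X : Set} (x : X) xs → 2 ≤ length xs → Unique (x ∷ xs) → ∀ {s} → s ∈ x ∷ xs →
  ∃₂ λ t₁ t₂ → t₁ ≢ t₂ × (t₁ , s) ∈ closing x (x ∷ xs) × (s , t₂) ∈ closing x (x ∷ xs)
closing-neighbours x (_ ∷ []) (s≤s ())
-- The first vertex has the last and the second as neighbours; with three or more entries these
-- differ.
closing-neighbours x (y ∷ z ∷ r) _ (_ ∷ y∉ ∷ _) (here refl)
  with l , l∈ , p ← closing-last x z r = l , y , ≢-sym (All.lookup y∉ l∈) , there (there p) , here refl
closing-neighbours x (y ∷ z ∷ r) _ ((_ ∷ x≢z ∷ _) ∷ _) (there (here refl)) =
  x , z , x≢z , here refl , there (here refl)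
closing-neighbours x (y ∷ z ∷ r) _ (x∉ ∷ u) (there (there s∈))
  with t₁ , t₂ , ne , p , q ← closing-mid (z ∷ r) u (λ x∈ → All.lookup x∉ x∈ refl) s∈ =
  t₁ , t₂ , ne , there p , there q

cycle-neighbours : ∀ {X : Set} (C : List X) → 3 ≤ length C → Unique C → ∀ {s} → s ∈ C →
  ∃₂ λ t₁ t₂ → t₁ ≢ t₂ × (t₁ , s) ∈ cycPairs C × (s , t₂) ∈ cycPairs C
cycle-neighbours (x ∷ xs) (s≤s len) u s∈ rewrite cycPairs≡closing x xs = closing-neighbours x xs len u s∈

-- Each pair flips the colour, and there are as many pairs as entries until `x` is reached.
closing-parity : ∀ {X : Set} (c : X → Bool) x y ys → (∀ {a b} → (a , b) ∈ closing x (y ∷ ys) → c a xor c b ≡ true) →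
  c y xor c x ≡ odd (length (y ∷ ys))
closing-parity c x y [] alt = alt (here refl)
closing-parity c x y (z ∷ r) alt with c y | c z | alt (here refl) | closing-parity c x z r (alt ∘ there)
... | true | false | _ | eq = cong not eq
... | false | true | _ | eq = trans (sym (not-involutive _)) (cong not eq)

cycle-parity : ∀ {X : Set} (c : X → Bool) C → (∀ {a b} → (a , b) ∈ cycPairs C → c a xor c b ≡ true) →
  odd (length C) ≡ false
cycle-parity c [] alt = refl
cycle-parity c (x ∷ xs) alt rewrite cycPairs≡closing x xs =
  trans (sym (closing-parity c x x xs alt)) (xor-same (c x))

-- Paths

module _ {G : Graph} where

  reach-trans : ∀ {x y z} → Reach G x y → Reach G y z → Reach G x z
  reach-trans here q = q
  reach-trans (step a p) q = step a (reach-trans p q)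

  adj-sym : ∀ {x y} → Adj G x y → Adj G y x
  adj-sym (inj₁ p) = inj₂ p
  adj-sym (inj₂ p) = inj₁ p

  reach-sym : ∀ {x y} → Reach G x y → Reach G y x
  reach-sym here = here
  reach-sym (step a p) = reach-trans (reach-sym p) (step (adj-sym a) here)

  data Path : Fin (n G) → Fin (n G) → List (Fin (n G)) → Set where
    stop : ∀ {x} → Path x x (x ∷ [])
    cons : ∀ {x y z p} → Adj G x y → x ∉ p → Path y z p → Path x z (x ∷ p)

  path-from : ∀ {x y z p} → x ∈ p → Path y z p → ∃ λ q → Path x z q
  path-from (here refl) P@stop = _ , P
  path-from (here refl) P@(cons _ _ _) = _ , P
  path-from (there x∈) (cons _ _ P) = path-from x∈ P

  -- Loop erasure: if the new starting vertex already lies on the path, the path is restarted there.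
  reach⇒path : ∀ {x y} → Reach G x y → ∃ λ p → Path x y p
  reach⇒path here = _ , stop
  reach⇒path {x} (step a r) with p , P ← reach⇒path r with _∈?_ F._≟_ x p
  ... | yes x∈ = path-from x∈ P
  ... | no x∉ = _ , cons a x∉ P

  path-unique : ∀ {x y p} → Path x y p → Unique p
  path-unique stop = [] ∷ []
  path-unique (cons _ x∉ P) = All.tabulate (λ { y∈ refl → x∉ y∈ }) ∷ path-unique P

  -- Needed so that closing the path by an edge gives a genuine cycle: one vertex would make the
  -- ends equal, two would make them adjacent.
  path-length : ∀ {x y p} → Path x y p → x ≢ y → ¬ Adj G x y → 3 ≤ length p
  path-length stop x≢y _ = contradiction refl x≢y
  path-length (cons a _ stop) _ ¬a = contradiction a ¬a
  path-length (cons _ _ (cons _ _ stop)) _ _ = s≤s (s≤s (s≤s z≤n))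
  path-length (cons _ _ (cons _ _ (cons _ _ _))) _ _ = s≤s (s≤s (s≤s z≤n))

  path-closing : ∀ {P : Fin (n G) × Fin (n G) → Set} {x₀ x y p} → (∀ {u w} → Adj G u w → P (u , w)) →
    P (y , x₀) → Path x y p → All P (closing x₀ p)
  path-closing f c stop = c ∷ []
  path-closing f c (cons a _ stop) = f a ∷ c ∷ []
  path-closing f c (cons a _ P@(cons _ _ _)) = f a ∷ path-closing f c P

  path-head : ∀ {x y p} → Path x y p → ∃ λ r → p ≡ x ∷ r
  path-head stop = _ , refl
  path-head (cons _ _ _) = _ , refl

module _ {m} {es es' : List (Edge m)} (sub : ∀ {e} → e ∈ es → e ∈ es') where

  adj-⊆ : ∀ {x y} → Adj (graph m es) x y → Adj (graph m es') x y
  adj-⊆ (inj₁ p) = inj₁ (sub p)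
  adj-⊆ (inj₂ p) = inj₂ (sub p)

  reach-⊆ : ∀ {x y} → Reach (graph m es) x y → Reach (graph m es') x y
  reach-⊆ here = here
  reach-⊆ (step a p) = step (adj-⊆ a) (reach-⊆ p)

  cycle-⊆ : ∀ {C} → IsCycle (graph m es) C → IsCycle (graph m es') C
  cycle-⊆ (len , u , adj) = len , u , All.map adj-⊆ adj

-- Forests

-- Each component is labelled by one of its vertices, so the labels fixed by
-- the labelling count the components.
record Forest {m} (es : List (Edge m)) : Set where
  field
    colour : Fin m → Bool
    proper : Proper colour es
    label : Fin m → Fin m
    label-edge : ∀ {x y} → (x , y) ∈ es → label x ≡ label y
    label-reach : ∀ {x y} → label x ≡ label y → Reach (graph m es) x y
    label-idem : ∀ x → label (label x) ≡ label x
    -- A forest has as many components as vertices minus edges; modulo two the difference is a sum.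
    components : ⨁ (λ v → ⌊ label v F.≟ v ⌋) ≡ odd (m + length es)

forest-[] : ∀ {m} → Forest {m} []
forest-[] {m} = record
  { colour = λ _ → true
  ; proper = λ ()
  ; label = λ v → v
  ; label-edge = λ ()
  ; label-reach = λ { refl → here }
  ; label-idem = λ _ → refl
  ; components = trans (⨁-cong {m} ⌊≟⌋-refl) (trans (⨁-true m) (cong odd (sym (ℕₚ.+-identityʳ m))))
  }

-- An edge between two components merges them: the component of `x` has its colours switched if
-- necessary and takes over the label of `y`. One root is lost and one edge gained.
forest-∷ : ∀ {m} {es : List (Edge m)} {x y} (F : Forest es) →
  Forest.label F x ≢ Forest.label F y → Forest ((x , y) ∷ es)
forest-∷ {m} {es} {x} {y} F lx≢ly = record
  { colour = proj₁ recoloured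
  ; proper = proj₂ recoloured
  ; label = l'
  ; label-edge = label-edge'
  ; label-reach = λ {u} {w} → label-reach' u w
  ; label-idem = label-idem'
  ; components = trans (⨁-cong root)
      (trans (⨁-xor (λ v → ⌊ l v F.≟ v ⌋) (λ v → ⌊ v F.≟ l x ⌋))
      (trans (cong₂ _xor_ (Forest.components F) (⨁-point (λ _ → true) (l x)))
      (trans (xor-true _) (cong odd (sym (ℕₚ.+-suc m (length es)))))))
  }
  where
  l = Forest.label F
  recoloured : Bipartite ((x , y) ∷ es)
  recoloured = recolour {c = Forest.colour F} {P = λ v → ⌊ l v F.≟ l x ⌋} (Forest.proper F)
    (λ e∈ → cong (λ k → ⌊ k F.≟ l x ⌋) (Forest.label-edge F e∈))
    (cong₂ _xor_ (⌊≟⌋-refl (l x)) (⌊≟⌋-≢ (≢-sym lx≢ly)))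
  merge : Fin m → Fin m
  merge k = if ⌊ k F.≟ l x ⌋ then l y else k
  l' : Fin m → Fin m
  l' v = merge (l v)
  merge-x : merge (l x) ≡ l y
  merge-x rewrite ⌊≟⌋-refl (l x) = refl
  merge-≢ : ∀ {k} → k ≢ l x → merge k ≡ k
  merge-≢ k≢ rewrite ⌊≟⌋-≢ k≢ = refl
  label-edge' : ∀ {u w} → (u , w) ∈ (x , y) ∷ es → l' u ≡ l' w
  label-edge' (here refl) = trans merge-x (sym (merge-≢ (≢-sym lx≢ly)))
  label-edge' (there e∈) = cong merge (Forest.label-edge F e∈)
  reach : ∀ {u w} → l u ≡ l w → Reach (graph m ((x , y) ∷ es)) u w
  reach eq = reach-⊆ there (Forest.label-reach F eq)
  label-reach' : ∀ u w → l' u ≡ l' w → Reach (graph m ((x , y) ∷ es)) u w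
  label-reach' u w eq with l u F.≟ l x | l w F.≟ l x
  ... | yes p | yes q = reach (trans p (sym q))
  ... | yes p | no _ = reach-trans (reach p) (step (inj₁ (here refl)) (reach eq))
  ... | no _ | yes q = reach-trans (reach eq) (step (inj₂ (here refl)) (reach (sym q)))
  ... | no _ | no _ = reach eq
  label-idem' : ∀ v → l' (l' v) ≡ l' v
  label-idem' v with l v F.≟ l x
  ... | yes _ = trans (cong merge (Forest.label-idem F y)) (merge-≢ (≢-sym lx≢ly))
  ... | no lv≢ = trans (cong merge (Forest.label-idem F v)) (merge-≢ lv≢)
  -- The vertex `l x` is the one root that is lost, and no new root arises.
  root : ∀ v → ⌊ l' v F.≟ v ⌋ ≡ ⌊ l v F.≟ v ⌋ xor ⌊ v F.≟ l x ⌋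
  root v with l v F.≟ l x
  ... | yes p rewrite p | ⌊≟⌋-≢ {x = l y} {v} (λ { refl → lx≢ly (trans (sym p) (Forest.label-idem F y)) })
    | ⌊≟⌋-sym (l x) v = sym (xor-same ⌊ v F.≟ l x ⌋)
  ... | no lv≢ rewrite ⌊≟⌋-≢ {x = v} {l x} (λ { refl → lv≢ (Forest.label-idem F x) }) = sym (xor-identityʳ _)

WF : ∀ {m} → List (Edge m) → Set
WF {m} es = WellFormed (graph m es)

wf-adj : ∀ {m} {es : List (Edge m)} {x y} → WF ((x , y) ∷ es) → ¬ Adj (graph m es) x y
wf-adj (_ , (x∉ ∷ _)) (inj₁ e∈) = All.lookup x∉ e∈ refl
wf-adj ((x<y ∷ lt) , _) (inj₂ e∈) = ℕₚ.<-asym x<y (All.lookup lt e∈)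

-- Edges are added one at a time: a new edge either joins two components or closes a path within one
-- component to a cycle.
forest-or-cycle : ∀ {m} (es : List (Edge m)) → WF es → Forest es ⊎ ∃ (IsCycle (graph m es))
forest-or-cycle [] _ = inj₁ forest-[]
forest-or-cycle {m} ((x , y) ∷ es) wf@((x<y ∷ lt) , (_ ∷ u)) with forest-or-cycle es (lt , u)
... | inj₂ (C , cyc) = inj₂ (C , cycle-⊆ there cyc)
... | inj₁ F with Forest.label F x F.≟ Forest.label F y
...   | no lx≢ly = inj₁ (forest-∷ F lx≢ly)
...   | yes eq with p , P ← reach⇒path (Forest.label-reach F eq) with r , refl ← path-head P =
  inj₂ (x ∷ r , path-length P (λ x≡y → FP.<-irrefl x≡y x<y) (wf-adj wf) , path-unique P
    , subst (All _) (sym (cycPairs≡closing x r))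
        (path-closing (adj-⊆ there) (inj₂ (here refl)) P))

-- Well-formed edge lists, neighbours and degrees

unique-↭ : ∀ {X : Set} {xs ys : List X} → xs ↭ ys → Unique xs → Unique ys
unique-↭ Perm.refl u = u
unique-↭ (prep x p) (x∉ ∷ u) = All-resp-↭ p x∉ ∷ unique-↭ p u
unique-↭ (swap x y p) ((x≢y ∷ x∉) ∷ y∉ ∷ u) =
  (≢-sym x≢y ∷ All-resp-↭ p y∉) ∷ All-resp-↭ p x∉ ∷ unique-↭ p u
unique-↭ (Perm.trans p q) u = unique-↭ q (unique-↭ p u)

wf-↭ : ∀ {m} {es es' : List (Edge m)} → es ↭ es' → WF es → WF es'
wf-↭ p (lt , u) = All-resp-↭ p lt , unique-↭ p u

wf-tail : ∀ {m} {es : List (Edge m)} {e} → WF (e ∷ es) → WF es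
wf-tail ((_ ∷ lt) , (_ ∷ u)) = lt , u

adj-≢ : ∀ {m} {es : List (Edge m)} → WF es → ∀ {x y} → Adj (graph m es) x y → x ≢ y
adj-≢ (lt , _) (inj₁ e∈) x≡y = FP.<-irrefl x≡y (All.lookup lt e∈)
adj-≢ (lt , _) (inj₂ e∈) x≡y = FP.<-irrefl (sym x≡y) (All.lookup lt e∈)

adj⇒joins : ∀ {m} {es : List (Edge m)} {x y} → Adj (graph m es) x y → ∃ λ e → e ∈ es × Joins e x y
adj⇒joins (inj₁ e∈) = _ , e∈ , inj₁ refl
adj⇒joins (inj₂ e∈) = _ , e∈ , inj₂ refl

joins⇒adj : ∀ {m} {es : List (Edge m)} {e x y} → e ∈ es → Joins e x y → Adj (graph m es) x y
joins⇒adj e∈ (inj₁ refl) = inj₁ e∈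
joins⇒adj e∈ (inj₂ refl) = inj₂ e∈

joins-unique : ∀ {m} {e : Edge m} {s t t'} → Joins e s t → Joins e s t' → t ≡ t'
joins-unique (inj₁ refl) (inj₁ refl) = refl
joins-unique (inj₁ refl) (inj₂ refl) = refl
joins-unique (inj₂ refl) (inj₁ refl) = refl
joins-unique (inj₂ refl) (inj₂ refl) = refl

-- An edge at `s` determines its other end, so removing the edge to one neighbour leaves the edges
-- to the others.
neighbours≤degree : ∀ {m} (es : List (Edge m)) s ws → Unique ws →
  (∀ {w} → w ∈ ws → Adj (graph m es) s w) → length ws ≤ degL s es
neighbours≤degree es s [] _ _ = z≤n
neighbours≤degree {m} es s (w ∷ ws) (w∉ ∷ u) adj with e , e∈ , j ← adj⇒joins (adj (here refl))
  with es' , p ← ∈⇒↭ e∈ rewrite degL-↭ s p | degL-∷ s e es' | touches-joins-A j =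
  s≤s (neighbours≤degree es' s ws u adj')
  where
  adj' : ∀ {w'} → w' ∈ ws → Adj (graph m es') s w'
  adj' w'∈ with e' , e'∈ , j' ← adj⇒joins (adj (there w'∈)) with ∈-resp-↭ p e'∈
  ... | here refl = contradiction (joins-unique j j') (All.lookup w∉ w'∈)
  ... | there e'∈' = joins⇒adj e'∈' j'

odd-%2 : ∀ k {b} → k % 2 ≡ toℕ b → odd k ≡ b
odd-%2 zero {false} eq = refl
odd-%2 (suc zero) {true} eq = refl
odd-%2 (suc (suc k)) eq = trans (not-involutive _) (odd-%2 k eq)

-- The odd cycle of a pseudotree

cycEdge-sym : ∀ {m} (C : List (Fin m)) {x y} → CycEdge C x y → CycEdge C y x
cycEdge-sym C (inj₁ p) = inj₂ p
cycEdge-sym C (inj₂ p) = inj₁ p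

cycEdge-∈ : ∀ {m} (C : List (Fin m)) {x y} → CycEdge C x y → x ∈ C × y ∈ C
cycEdge-∈ C (inj₁ p) = cycPairs-∈ C p
cycEdge-∈ C (inj₂ p) = proj₂ (cycPairs-∈ C p) , proj₁ (cycPairs-∈ C p)

module _ {m} {es : List (Edge m)} {C : List (Fin m)} (cyc : IsCycle (graph m es) C) where

  pair-adj : ∀ {x y} → (x , y) ∈ cycPairs C → Adj (graph m es) x y
  pair-adj p = All.lookup (proj₂ (proj₂ cyc)) p

  cycEdge-adj : ∀ {x y} → CycEdge C x y → Adj (graph m es) x y
  cycEdge-adj (inj₁ p) = pair-adj p
  cycEdge-adj (inj₂ p) = adj-sym (pair-adj p)

  neighbours : ∀ {s} → s ∈ C → ∃₂ λ t₁ t₂ → t₁ ≢ t₂ × CycEdge C s t₁ × CycEdge C s t₂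
  neighbours s∈ with t₁ , t₂ , ne , p , q ← cycle-neighbours C (proj₁ cyc) (proj₁ (proj₂ cyc)) s∈ =
    t₁ , t₂ , ne , inj₂ p , inj₁ q

  not-bipartite : odd (length C) ≡ true → ¬ Bipartite es
  not-bipartite oddC (c , proper) = contradiction (trans (sym oddC) (cycle-parity c C alternate)) λ ()
    where
    alternate : ∀ {a b} → (a , b) ∈ cycPairs C → c a xor c b ≡ true
    alternate {a} {b} p with pair-adj p
    ... | inj₁ e∈ = proper e∈
    ... | inj₂ e∈ = trans (Bool.xor-comm (c a) (c b)) (proper e∈)

  module _ (wf : WF es) (oddC : odd (length C) ≡ true)
    (unique : ∀ C' → IsCycle (graph m es) C' → ∀ {x y} → CycEdge C x y → CycEdge C' x y) where

    -- A cycle surviving in `es'` would be a cycle of `es` and hence contain the cut edge, which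
    -- well-formedness keeps from occurring twice.
    cut-forest : ∀ {x y es'} → es ↭ (x , y) ∷ es' → CycEdge C x y → Forest es'
    cut-forest {x} {y} {es'} p xy with forest-or-cycle es' (wf-tail (wf-↭ p wf))
    ... | inj₁ F = F
    ... | inj₂ (C' , cyc') = contradiction
      (adj' (unique C' (cycle-⊆ (∈-resp-↭ (↭-sym p) ∘ there) cyc') xy)) (wf-adj (wf-↭ p wf))
      where
      adj' : CycEdge C' x y → Adj (graph m es') x y
      adj' (inj₁ q) = All.lookup (proj₂ (proj₂ cyc')) q
      adj' (inj₂ q) = adj-sym (All.lookup (proj₂ (proj₂ cyc')) q)

    -- Cutting the cycle leaves a tree, hence as many edges as vertices minus one.
    order-parity : Connected (graph m es) → ∀ {x y es'} → es ↭ (x , y) ∷ es' → CycEdge C x y →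
      odd m ≡ odd (length es)
    order-parity connected {x} {y} {es'} p xy with F ← cut-forest p xy
      with Forest.label F x F.≟ Forest.label F y
    -- With different labels the cut edge could be restored to the forest, and a graph with an odd
    -- cycle would be two-coloured.
    ... | no lx≢ly = let F' = forest-∷ F lx≢ly in
      contradiction (Bipartite-⊆ (∈-resp-↭ p) (Forest.colour F' , Forest.proper F')) (not-bipartite oddC)
    ... | yes lx≡ly = trans (bits (odd m) (odd (length es')) tree) (sym (odd-length-↭ p))
      where
      l = Forest.label F
      bits : ∀ a b → a xor b ≡ true → a ≡ not b
      bits true false _ = refl
      bits false true _ = refl
      edge-label : ∀ {u w} → (u , w) ∈ es → l u ≡ l w
      edge-label e∈ with ∈-resp-↭ p e∈
      ... | here refl = lx≡ly
      ... | there e∈' = Forest.label-edge F e∈'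
      reach-label : ∀ {u w} → Reach (graph m es) u w → l u ≡ l w
      reach-label here = refl
      reach-label (step (inj₁ e∈) r) = trans (edge-label e∈) (reach-label r)
      reach-label (step (inj₂ e∈) r) = trans (sym (edge-label e∈)) (reach-label r)
      -- Connectedness leaves a single label, so `l x` is the only root.
      root : ∀ v → ⌊ l v F.≟ v ⌋ ≡ ⌊ v F.≟ l x ⌋
      root v rewrite reach-label (connected v x) = ⌊≟⌋-sym (l x) v
      tree : odd m xor odd (length es') ≡ true
      tree = trans (sym (odd-+ m (length es'))) (trans (sym (Forest.components F))
        (trans (⨁-cong root) (⨁-point (λ _ → true) (l x))))

    -- Without the edge to `B` every cycle vertex has degree two, which its two cycle neighbours use
    -- up; hence no other edge meets the cycle and it is detached in `rest`.
    attach : ∀ {A B} → A ∈ C → deg (graph m es) A ≡ 3 →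
      (∀ x → x ∈ C → x ≢ A → deg (graph m es) x ≡ 2) → Adj (graph m es) A B → B ∉ C →
      AttachedCycle es (λ x → ⌊ _∈?_ F._≟_ x C ⌋) A B
    attach {A} {B} A∈ deg-A deg-other adj-AB B∉ with ab , ab∈ , j ← adj⇒joins adj-AB
      with rest , split ← ∈⇒↭ ab∈ = record
      { joins = j
      ; split = split
      ; detached = record
        { inhabited = A , S⁺ A∈
        ; incident = λ s Ss → let t , _ , _ , st , _ = neighbours (S⁻ Ss) in
            t , S⁺ (proj₂ (cycEdge-∈ C st)) , adj-≢ wf (cycEdge-adj st) , cycEdge-rest st
        ; closed = closed'
        ; evenDeg = λ s Ss → cong odd (degree (S⁻ Ss))
        ; cut = cut'
        }
      ; A-inside = S⁺ A∈
      ; B-outside = S-outside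
      }
      where
      S : Fin m → Bool
      S x = ⌊ _∈?_ F._≟_ x C ⌋
      S⁺ : ∀ {x} → x ∈ C → S x ≡ true
      S⁺ {x} x∈ with _∈?_ F._≟_ x C
      ... | yes _ = refl
      ... | no x∉ = contradiction x∈ x∉
      S⁻ : ∀ {x} → S x ≡ true → x ∈ C
      S⁻ {x} eq with _∈?_ F._≟_ x C
      ... | yes x∈ = x∈
      S-outside : S B ≡ false
      S-outside with _∈?_ F._≟_ B C
      ... | yes B∈ = contradiction B∈ B∉
      ... | no _ = refl
      cycEdge-rest : ∀ {x y} → CycEdge C x y → Adj (graph m rest) x y
      cycEdge-rest xy with e , e∈ , j' ← adj⇒joins (cycEdge-adj xy) with ∈-resp-↭ split e∈
      ... | there e∈' = joins⇒adj e∈' j'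
      ... | here refl = contradiction (meets j j' (cycEdge-∈ C xy)) B∉
        where
        meets : ∀ {e x y} → Joins e A B → Joins e x y → x ∈ C × y ∈ C → B ∈ C
        meets (inj₁ refl) (inj₁ refl) (_ , B∈) = B∈
        meets (inj₁ refl) (inj₂ refl) (B∈ , _) = B∈
        meets (inj₂ refl) (inj₁ refl) (B∈ , _) = B∈
        meets (inj₂ refl) (inj₂ refl) (_ , B∈) = B∈
      degree-split : ∀ s → degL s es ≡ toℕ (touches s ab) + degL s rest
      degree-split s = trans (degL-↭ s split) (degL-∷ s ab rest)
      degree : ∀ {s} → s ∈ C → degL s rest ≡ 2
      degree {s} s∈ with s F.≟ A
      ... | yes refl = ℕₚ.suc-injective (trans (sym (trans (degree-split s)
        (cong (λ b → toℕ b + degL s rest) (touches-joins-A j)))) deg-A)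
      ... | no s≢A = trans (sym (trans (degree-split s)
        (cong (λ b → toℕ b + degL s rest) (touches-joins-≢ j s≢A λ { refl → B∉ s∈ })))) (deg-other s s∈ s≢A)
      -- A neighbour not joined to `s` by a cycle edge would be a third one, against degree two.
      only-cycle : ∀ {s w} → s ∈ C → Adj (graph m rest) s w → CycEdge C s w
      only-cycle {s} {w} s∈ sw with t₁ , t₂ , t₁≢t₂ , st₁ , st₂ ← neighbours s∈ with w F.≟ t₁ | w F.≟ t₂
      ... | yes refl | _ = st₁
      ... | no _ | yes refl = st₂
      ... | no w≢t₁ | no w≢t₂ = contradiction
        (subst (3 ≤_) (degree s∈) (neighbours≤degree rest s (w ∷ t₁ ∷ t₂ ∷ [])
          ((w≢t₁ ∷ w≢t₂ ∷ []) ∷ (t₁≢t₂ ∷ []) ∷ [] ∷ [])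
          λ { (here refl) → sw ; (there (here refl)) → cycEdge-rest st₁
            ; (there (there (here refl))) → cycEdge-rest st₂ }))
        λ { (s≤s (s≤s ())) }
      closed' : ∀ {x y} → (x , y) ∈ rest → S x ≡ S y
      closed' {x} {y} e∈ with S x in Sx | S y in Sy
      ... | true | true = refl
      ... | false | false = refl
      ... | true | false = trans (sym (S⁺ (proj₂ (cycEdge-∈ C (only-cycle (S⁻ Sx) (inj₁ e∈)))))) Sy
      ... | false | true = trans (sym Sx) (S⁺ (proj₂ (cycEdge-∈ C (only-cycle (S⁻ Sy) (inj₂ e∈)))))
      cut' : ∀ {x y es'} → rest ↭ (x , y) ∷ es' → S x ≡ true → ∃ λ c → c x ≡ c y × Proper c es'
      cut' {x} {y} {es'} q Sx = Forest.colour F , mono , Forest.proper F ∘ there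
        where
        p : es ↭ (x , y) ∷ ab ∷ es'
        p = ↭-trans split (↭-trans (prep ab q) (swap ab (x , y) ↭-refl))
        -- The forest retains the bridge, so only the cut edge is missing from `es`. Were its ends
        -- coloured differently, the odd cycle would be two-coloured.
        F : Forest (ab ∷ es')
        F = cut-forest p (only-cycle (S⁻ Sx) (inj₁ (∈-resp-↭ (↭-sym q) (here refl))))
        c = Forest.colour F
        extended : c x xor c y ≡ true → Proper c es
        extended xy e∈ with ∈-resp-↭ p e∈
        ... | here refl = xy
        ... | there e∈' = Forest.proper F e∈'
        bits : ∀ a b → (a xor b ≡ true → ⊥) → a ≡ b
        bits true true _ = refl
        bits true false ¬p = contradiction refl ¬p
        bits false true ¬p = contradiction refl ¬p
        bits false false _ = refl
        mono : c x ≡ c y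
        mono = bits (c x) (c y) λ xy → not-bipartite oddC (c , extended xy)

theorem4 : (G : Graph) → WellFormed G → IsPseudotree G → SimplestForm G →
    (C : List (Fin (n G))) → IsCycle G C → Odd (length C) →
    (A : Fin (n G)) → A ∈ C → deg G A ≡ 3 →
    (∀ x → x ∈ C → x ≢ A → deg G x ≡ 2) →
    (B : Fin (n G)) → Adj G A B → B ∉ C →
    (Odd (deg G B) → 4 ≤ nim G)
    × (Even (deg G B) → Odd (n G) → nim G ≡ 3)
    × (Even (deg G B) → Even (n G) → nim G ≡ 0)
theorem4 (graph m es) wf (connected , C₀ , _ , same) _ C cyc oddC A A∈ deg-A deg-other B adj-AB B∉ =
    (λ d → proj₁ value (odd-%2 (degL B es) d))
  , (λ d k → small d (odd-%2 m k))
  , (λ d k → small d (odd-%2 m k))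
  where
  oddC' : odd (length C) ≡ true
  oddC' = odd-%2 (length C) oddC
  unique : ∀ C' → IsCycle (graph m es) C' → ∀ {x y} → CycEdge C x y → CycEdge C' x y
  -- Both cycles are compared with the witness `C₀` of the pseudotree.
  unique C' cyc' {x} {y} xy = Equivalence.from (same C' cyc' x y) (Equivalence.to (same C cyc x y) xy)
  value : AttachedValue es B
  value = nim-attached es (attach cyc wf oddC' unique A∈ deg-A deg-other adj-AB B∉)
  parity : odd m ≡ odd (length es)
  parity with t , _ , _ , At , _ ← neighbours cyc A∈ with cycEdge-adj cyc At
  ... | inj₁ e∈ = order-parity cyc wf oddC' unique connected (proj₂ (∈⇒↭ e∈)) At
  ... | inj₂ e∈ = order-parity cyc wf oddC' unique connected (proj₂ (∈⇒↭ e∈)) (cycEdge-sym C At)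
  -- Vertices and edges have equal parity, so both digits of `φ` agree: the value is 3 for odd order
  -- and 0 for even order.
  small : ∀ {k} → Even (deg (graph m es) B) → odd m ≡ k → nim (graph m es) ≡ val k k
  small d eq = trans (proj₂ value (odd-%2 (degL B es) d)) (cong₂ val eq (trans (sym parity) eq))
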